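{- Let $j,r\ge 0$ and $k\ge 1$ be integers with $j+r\le k$. Then \[ \sum_{s_1\ge\cdots\ge s_k\ge 0}\frac{q^{s_1^2+\cdots+s_k^2-s_1-\cdots-s_j+s_{k-r+1}+\cdots+s_k}}{(q)_{s_1-s_2}\cdots(q)_{s_{k-1}-s_k}(q^2;q^2)_{s_k}}=\sum_{f}q^{|f|}, \] where the sum on the right runs over all frequency sequences $f=(f_i)_{i\ge0}$ such that (i) $f_i+f_{i+1}\le k$ for all $i\ge0$, (ii) $f_0\le j-\max\{f_0+f_1-(k-r),0\}$, and (iii) whenever $f_i+f_{i+1}=k$ for some $i\ge0$, we have $if_i+(i+1)f_{i+1}\equiv k+r-j\pmod 2$.
   Context: A frequency sequence is a sequence $(f_i)_{i\ge0}$ of non-negative integers with only finitely many nonzero entries; its size is $|f|=\sum_{i\ge0} i f_i$. $q$ is a complex number with $|q|<1$ (or a formal variable); $(a;q)_n=\prod_{m=0}^{n-1}(1-aq^m)$, $(a)_n=(a;q)_n$. $s_1+\cdots+s_j=\sum_{i=1}^j s_i$, $s_{k-r+1}+\cdots+s_k=\sum_{i=k-r+1}^k s_i$. -}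

module Defs where

open import Data.Nat using (ℕ; zero; suc; _+_; _*_; _∸_; _≤_; _≤?_; _≡ᵇ_)
open import Data.Nat.DivMod using (_%_)
open import Data.Nat.Divisibility using (_∣?_)
open import Data.Bool using (Bool; true; false; if_then_else_; _∧_)
open import Data.Nat.ListAction using (sum)
open import Data.List using (List; []; _∷_; [_]; upTo; map; concatMap; take; drop; length; zipWith)
open import Data.Vec using (Vec; toList)
open import Data.Product using (_×_)
open import Relation.Nullary.Decidable using (⌊_⌋)
open import Relation.Binary.PropositionalEquality using (_≡_)

-- Formal power series in q with natural-number coefficients
-- (all series occurring in the left-hand side have nonnegative coefficients)

PS : Set
PS = ℕ → ℕ

_⊛_ : PS → PS → PS
(A ⊛ B) n = sum (map (λ i → A i * B (n ∸ i)) (upTo (suc n)))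

one : PS
one zero    = 1
one (suc _) = 0

-- geom a = 1 / (1 - q^a) = Σ_t q^(a t)   (used only with a ≥ 1)
geom : ℕ → PS
geom a n = if ⌊ a ∣? n ⌋ then 1 else 0

invQPoch : ℕ → ℕ → PS
invQPoch st zero    = one
invQPoch st (suc m) = invQPoch st m ⊛ geom (st * suc m)

denom : List ℕ → PS
denom []           = one
denom (x ∷ [])     = invQPoch 2 x
denom (x ∷ y ∷ t)  = invQPoch 1 (x ∸ y) ⊛ denom (y ∷ t)

nonincr : List ℕ → Bool
nonincr (x ∷ y ∷ t) = ⌊ y ≤? x ⌋ ∧ nonincr (y ∷ t)
nonincr _           = true

tuples : ℕ → ℕ → List (List ℕ)
tuples zero    N = [ [] ]
tuples (suc k) N = concatMap (λ x → map (x ∷_) (tuples k N)) (upTo (suc N))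

-- exponent s_1^2+⋯+s_k^2 - s_1 - ⋯ - s_j + s_{k-r+1} + ⋯ + s_k
-- (nonnegative, since s_i^2 ≥ s_i, so truncated subtraction is exact)
expo : ℕ → ℕ → ℕ → List ℕ → ℕ
expo j r k s = (sum (map (λ x → x * x) s) + sum (drop (k ∸ r) s)) ∸ sum (take j s)

termCoeff : ℕ → ℕ → ℕ → List ℕ → ℕ → ℕ
termCoeff j r k s n =
  if ⌊ expo j r k s ≤? n ⌋ then denom s (n ∸ expo j r k s) else 0

lhsTrunc : ℕ → ℕ → ℕ → ℕ → ℕ → ℕ
lhsTrunc j r k N n =
  sum (map (λ s → if nonincr s then termCoeff j r k s n else 0) (tuples k N))

getL : List ℕ → ℕ → ℕ
getL []      _       = 0
getL (x ∷ _) zero    = x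
getL (_ ∷ t) (suc i) = getL t i

-- A frequency sequence of size n has f_i = 0 for all i > n, so it is
-- exactly a vector (f_0,…,f_n) (entries beyond n are 0).
freq : ∀ {m} → Vec ℕ m → ℕ → ℕ
freq v = getL (toList v)

size : ∀ {m} → Vec ℕ m → ℕ
size v = sum (zipWith _*_ (upTo (length (toList v))) (toList v))

Valid : ℕ → ℕ → ℕ → (ℕ → ℕ) → Set
Valid j r k f =
  (∀ i → f i + f (suc i) ≤ k)
  × (f 0 + ((f 0 + f 1) ∸ (k ∸ r)) ≤ j)
  × (∀ i → f i + f (suc i) ≡ k →
       (i * f i + suc i * f (suc i)) % 2 ≡ ((k + r) ∸ j) % 2)

{-# OPTIONS --safe #-}

-- Write K for the paper's k, put a = j and b = K − r, so that a ≤ b ≤ K, and grade by p for the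
-- substitution x ↦ x q^p in the multisum L_p(a, b), where x marks s_1 + ⋯ + s_K. Both sides are
-- shown to satisfy
--   L_p(0, b) = L_{p+1}(b, K),
--   L_p(a, b) = L_p(a−1, b+1) + q^{pa} L_{p+1}(b−a, K)   for 1 ≤ a ≤ b < K,
--   L_p(a, K) = L_p(a−1, K−1) + q^{pa} L_{p+1}(K−a, K)   for 1 ≤ a ≤ K,
--   L_p(a, b) ≡ 1 (mod q^p),
-- which determine every coefficient.
-- For frequency sequences this is removal of f_0 from the conditions f_0 ≤ a, 2 f_0 + f_1 ≤ a + b
-- and i f_i + (i+1) f_{i+1} ≡ a + b (mod 2) whenever f_i + f_{i+1} = K; the last summand of each
-- relation collects the sequences with f_0 = a.
-- For the multisums, the sum over s_K is outermost and its inner sums are Andrews–Gordon multisums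
-- of level K − 1. The relation for b < K is inherited from the inner sums. For b = K, cancelling a
-- factor 1 − q^{d s_K} of the denominator and using the inner relation at b = K − 1 express
-- L_p(a, K) through the claim for (p + 1, K − a) with its two sides exchanged; as every second step
-- gains a power of q, the two sides agree coefficientwise. The case d = 1 is the induction step
-- for Andrews–Gordon multisums, the case d = 2 is the theorem.
module Submission where

open import Defs
open import Data.Bool using (true; false; if_then_else_; _∧_)
open import Data.Bool.Properties using (∧-zeroʳ)
open import Data.List using (List; []; _∷_; [_]; _++_; applyUpTo; concatMap; drop; length; map; take; upTo; zipWith)
open import Data.List.Membership.Propositional using (_∈_)
open import Data.List.Membership.Propositional.Properties using (∈-map⁺; ∈-map⁻; ∈-++⁺ˡ; ∈-++⁺ʳ; ∈-++⁻)
open import Data.List.Properties using (length-++; length-map; map-++; map-∘; take++drop≡id; ++-assoc; ++-identityʳ)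
import Data.List.Relation.Unary.All as All
import Data.List.Relation.Unary.AllPairs as AllPairs
open import Data.List.Relation.Unary.Any using (here)
open import Data.List.Relation.Unary.Unique.Propositional using (Unique)
import Data.List.Relation.Unary.Unique.Propositional.Properties as Unique
open import Data.Nat
open import Data.Nat.DivMod using (_%_)
open import Data.Nat.Divisibility using (_∣_; _∣?_; ∣m+n∣m⇒∣n; ∣m∣n⇒∣m+n; ∣-refl; ∣⇒≤; _∣0)
open import Data.Nat.ListAction using (sum)
open import Data.Nat.ListAction.Properties using (sum-++)
open import Data.Nat.Properties
open import Data.Nat.Tactic.RingSolver using (solve-∀)
open import Data.Parity.Base as ℙ using (0ℙ)
import Data.Parity.Properties as ℙₚ
open import Data.Product using (Σ; _×_; _,_; proj₁; proj₂)
open import Data.Sum using (_⊎_; inj₁; inj₂)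
open import Data.Vec using (Vec; []; _∷_; toList; head; tail)
open import Data.Vec.Properties using (∷-injectiveʳ)
open import Function using (_∘_; id)
open import Relation.Binary.PropositionalEquality hiding ([_])
open import Relation.Nullary using (¬_; yes; no; contradiction)
open import Relation.Nullary.Decidable using (⌊_⌋)
open ≡-Reasoning

-- Power series

Σ< : ℕ → (ℕ → ℕ) → ℕ
Σ< zero    f = 0
Σ< (suc M) f = f 0 + Σ< M (f ∘ suc)

Σ<-cong : ∀ M {f g} → f ≗ g → Σ< M f ≡ Σ< M g
Σ<-cong zero    eq = refl
Σ<-cong (suc M) eq = cong₂ _+_ (eq 0) (Σ<-cong M (eq ∘ suc))

+-interchange : ∀ a b c d → (a + b) + (c + d) ≡ (a + c) + (b + d)
+-interchange = solve-∀

Σ<-+ : ∀ M f g → Σ< M (λ m → f m + g m) ≡ Σ< M f + Σ< M g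
Σ<-+ zero    f g = refl
Σ<-+ (suc M) f g = trans (cong (f 0 + g 0 +_) (Σ<-+ M (f ∘ suc) (g ∘ suc)))
                         (+-interchange (f 0) (g 0) _ _)

Σ<-zero : ∀ M {f} → (∀ m → f m ≡ 0) → Σ< M f ≡ 0
Σ<-zero zero    z = refl
Σ<-zero (suc M) z = cong₂ _+_ (z 0) (Σ<-zero M (z ∘ suc))

Σ<-extend : ∀ {M M′} f → M ≤ M′ → (∀ m → M ≤ m → f m ≡ 0) → Σ< M′ f ≡ Σ< M f
Σ<-extend {M′ = M′} f z≤n z = Σ<-zero M′ (λ m → z m z≤n)
Σ<-extend f (s≤s M≤) z = cong (f 0 +_) (Σ<-extend (f ∘ suc) M≤ (λ m le → z (suc m) (s≤s le)))

sum-applyUpTo : ∀ (f : ℕ → ℕ) g M → sum (map f (applyUpTo g M)) ≡ Σ< M (f ∘ g)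
sum-applyUpTo f g zero    = refl
sum-applyUpTo f g (suc M) = cong (f (g 0) +_) (sum-applyUpTo f (g ∘ suc) M)

infixl 6 _⊕_

_⊕_ : PS → PS → PS
(A ⊕ B) n = A n + B n

shift : ℕ → PS → PS
shift zero    A n       = A n
shift (suc e) A zero    = 0
shift (suc e) A (suc n) = shift e A n

shift-cong : ∀ e {A B} → A ≗ B → shift e A ≗ shift e B
shift-cong zero    eq n       = eq n
shift-cong (suc e) eq zero    = refl
shift-cong (suc e) eq (suc n) = shift-cong e eq n

shift-≡ : ∀ {e e′} A → e ≡ e′ → shift e A ≗ shift e′ A
shift-≡ A refl n = refl

shift-⊕ : ∀ e A B → shift e (A ⊕ B) ≗ shift e A ⊕ shift e B
shift-⊕ zero    A B n       = refl
shift-⊕ (suc e) A B zero    = refl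
shift-⊕ (suc e) A B (suc n) = shift-⊕ e A B n

shift-shift : ∀ e e′ A → shift e (shift e′ A) ≗ shift (e + e′) A
shift-shift zero    e′ A n       = refl
shift-shift (suc e) e′ A zero    = refl
shift-shift (suc e) e′ A (suc n) = shift-shift e e′ A n

shift-< : ∀ {e n} A → n < e → shift e A n ≡ 0
shift-< {suc e} {zero}  A lt       = refl
shift-< {suc e} {suc n} A (s≤s lt) = shift-< A lt

shift-≥ : ∀ {e n} A → e ≤ n → shift e A n ≡ A (n ∸ e)
shift-≥ A z≤n       = refl
shift-≥ A (s≤s e≤n) = shift-≥ A e≤n

shift-if : ∀ e A n → (if ⌊ e ≤? n ⌋ then A (n ∸ e) else 0) ≡ shift e A n
shift-if e A n with e ≤? n
... | yes e≤n = sym (shift-≥ A e≤n)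
... | no  e≰n = sym (shift-< A (≰⇒> e≰n))

⊛-Σ< : ∀ A B n → (A ⊛ B) n ≡ Σ< (suc n) (λ i → A i * B (n ∸ i))
⊛-Σ< A B n = sum-applyUpTo (λ i → A i * B (n ∸ i)) id (suc n)

⊛-suc : ∀ A B n → (A ⊛ B) (suc n) ≡ A 0 * B (suc n) + ((A ∘ suc) ⊛ B) n
⊛-suc A B n = trans (⊛-Σ< A B (suc n)) (cong (A 0 * B (suc n) +_) (sym (⊛-Σ< (A ∘ suc) B n)))

⊛-cong : ∀ {A A′ B B′} → A ≗ A′ → B ≗ B′ → A ⊛ B ≗ A′ ⊛ B′
⊛-cong {A} {A′} {B} {B′} eA eB n = begin
  (A ⊛ B) n                              ≡⟨ ⊛-Σ< A B n ⟩
  Σ< (suc n) (λ i → A i * B (n ∸ i))     ≡⟨ Σ<-cong (suc n) (λ i → cong₂ _*_ (eA i) (eB (n ∸ i))) ⟩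
  Σ< (suc n) (λ i → A′ i * B′ (n ∸ i))   ≡⟨ ⊛-Σ< A′ B′ n ⟨
  (A′ ⊛ B′) n                            ∎

⊛-distribʳ : ∀ A A′ B → (A ⊕ A′) ⊛ B ≗ (A ⊛ B) ⊕ (A′ ⊛ B)
⊛-distribʳ A A′ B n = begin
  ((A ⊕ A′) ⊛ B) n                                        ≡⟨ ⊛-Σ< (A ⊕ A′) B n ⟩
  Σ< (suc n) (λ i → (A i + A′ i) * B (n ∸ i))             ≡⟨ Σ<-cong (suc n) (λ i → *-distribʳ-+ (B (n ∸ i)) (A i) (A′ i)) ⟩
  Σ< (suc n) (λ i → A i * B (n ∸ i) + A′ i * B (n ∸ i))   ≡⟨ Σ<-+ (suc n) (λ i → A i * B (n ∸ i)) (λ i → A′ i * B (n ∸ i)) ⟩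
  Σ< (suc n) (λ i → A i * B (n ∸ i)) + Σ< (suc n) (λ i → A′ i * B (n ∸ i))
    ≡⟨ cong₂ _+_ (⊛-Σ< A B n) (⊛-Σ< A′ B n) ⟨
  (A ⊛ B) n + (A′ ⊛ B) n                                  ∎

⊛-distribˡ : ∀ A B B′ → A ⊛ (B ⊕ B′) ≗ (A ⊛ B) ⊕ (A ⊛ B′)
⊛-distribˡ A B B′ n = begin
  (A ⊛ (B ⊕ B′)) n                                        ≡⟨ ⊛-Σ< A (B ⊕ B′) n ⟩
  Σ< (suc n) (λ i → A i * (B (n ∸ i) + B′ (n ∸ i)))       ≡⟨ Σ<-cong (suc n) (λ i → *-distribˡ-+ (A i) (B (n ∸ i)) (B′ (n ∸ i))) ⟩
  Σ< (suc n) (λ i → A i * B (n ∸ i) + A i * B′ (n ∸ i))   ≡⟨ Σ<-+ (suc n) (λ i → A i * B (n ∸ i)) (λ i → A i * B′ (n ∸ i)) ⟩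
  Σ< (suc n) (λ i → A i * B (n ∸ i)) + Σ< (suc n) (λ i → A i * B′ (n ∸ i))
    ≡⟨ cong₂ _+_ (⊛-Σ< A B n) (⊛-Σ< A B′ n) ⟨
  (A ⊛ B) n + (A ⊛ B′) n                                  ∎

⊛-identityʳ : ∀ A → A ⊛ one ≗ A
⊛-identityʳ A zero    = trans (⊛-Σ< A one 0) (trans (+-identityʳ _) (*-identityʳ (A 0)))
⊛-identityʳ A (suc n) = trans (⊛-suc A one n) (cong₂ _+_ (*-zeroʳ (A 0)) (⊛-identityʳ (A ∘ suc) n))

⊛-identityˡ : ∀ A → one ⊛ A ≗ A
⊛-identityˡ A n = trans (⊛-Σ< one A n)
  (trans (cong₂ _+_ (*-identityˡ (A n)) (Σ<-zero n (λ _ → refl))) (+-identityʳ (A n)))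

⊛-shiftˡ : ∀ e A B → shift e A ⊛ B ≗ shift e (A ⊛ B)
⊛-shiftˡ zero    A B n       = refl
⊛-shiftˡ (suc e) A B zero    = refl
⊛-shiftˡ (suc e) A B (suc n) = trans (⊛-suc (shift (suc e) A) B n) (⊛-shiftˡ e A B n)

⊛-shift1ʳ : ∀ A B n → (A ⊛ shift 1 B) (suc n) ≡ (A ⊛ B) n
⊛-shift1ʳ A B zero    = trans (⊛-suc A (shift 1 B) 0)
  (trans (cong (A 0 * B 0 +_) (trans (+-identityʳ _) (*-zeroʳ (A 1)))) refl)
⊛-shift1ʳ A B (suc n) = trans (⊛-suc A (shift 1 B) (suc n))
  (trans (cong (A 0 * B (suc n) +_) (⊛-shift1ʳ (A ∘ suc) B n)) (sym (⊛-suc A B n)))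

⊛-shiftʳ : ∀ e A B → A ⊛ shift e B ≗ shift e (A ⊛ B)
⊛-shiftʳ zero    A B n       = refl
⊛-shiftʳ (suc e) A B zero    = trans (+-identityʳ _) (*-zeroʳ (A 0))
⊛-shiftʳ (suc e) A B (suc n) = begin
  (A ⊛ shift (suc e) B) (suc n)     ≡⟨ ⊛-cong {A} (λ _ → refl) (λ i → sym (shift-shift 1 e B i)) (suc n) ⟩
  (A ⊛ shift 1 (shift e B)) (suc n) ≡⟨ ⊛-shift1ʳ A (shift e B) n ⟩
  (A ⊛ shift e B) n                 ≡⟨ ⊛-shiftʳ e A B n ⟩
  shift e (A ⊛ B) n                 ∎

geom-rec : ∀ a → geom (suc a) ≗ one ⊕ shift (suc a) (geom (suc a))
geom-rec a n with suc a ≤? n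
geom-rec a zero | no _ with suc a ∣? 0
... | yes _  = refl
... | no ¬d  = contradiction (suc a ∣0) ¬d
geom-rec a (suc n) | no a≰n with suc a ∣? suc n
... | yes d = contradiction (∣⇒≤ d) a≰n
... | no _  = sym (shift-< (geom (suc a)) (≰⇒> a≰n))
geom-rec a (suc n) | yes (s≤s a≤n) rewrite shift-≥ {a} {n} (geom (suc a)) a≤n
  with suc a ∣? suc n | suc a ∣? (n ∸ a)
... | yes _ | yes _ = refl
... | no _  | no _  = refl
... | yes d | no ¬d = contradiction (∣m+n∣m⇒∣n (subst (suc a ∣_) (cong suc (sym (m+[n∸m]≡n a≤n))) d) ∣-refl) ¬d
... | no ¬d | yes d = contradiction (subst (suc a ∣_) (cong suc (m+[n∸m]≡n a≤n)) (∣m∣n⇒∣m+n ∣-refl d)) ¬d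

-- Q satisfies the recursion (1 − q^(d(m+1))) Q (m+1) = Q m of Q m = G / (q^d; q^d)_m.
Telescopes : ℕ → (ℕ → PS) → Set
Telescopes d Q = ∀ m → Q (suc m) ≗ Q m ⊕ shift (d * suc m) (Q (suc m))

invQPoch-telescopes : ∀ d → Telescopes (suc d) (invQPoch (suc d))
invQPoch-telescopes d m n = begin
  (Q ⊛ geom e) n                            ≡⟨ ⊛-cong {Q} (λ _ → refl) (geom-rec (m + d * suc m)) n ⟩
  (Q ⊛ (one ⊕ shift e (geom e))) n          ≡⟨ ⊛-distribˡ Q one (shift e (geom e)) n ⟩
  (Q ⊛ one) n + (Q ⊛ shift e (geom e)) n    ≡⟨ cong₂ _+_ (⊛-identityʳ Q n) (⊛-shiftʳ e Q (geom e) n) ⟩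
  Q n + shift e (Q ⊛ geom e) n              ∎
  where
  e = suc d * suc m
  Q = invQPoch (suc d) m

⊛-telescopes : ∀ d Q G → Telescopes d Q → Telescopes d (λ m → Q m ⊛ G)
⊛-telescopes d Q G tel m n = begin
  (Q (suc m) ⊛ G) n                                    ≡⟨ ⊛-cong {B = G} (tel m) (λ _ → refl) n ⟩
  ((Q m ⊕ shift (d * suc m) (Q (suc m))) ⊛ G) n        ≡⟨ ⊛-distribʳ (Q m) _ G n ⟩
  (Q m ⊛ G) n + (shift (d * suc m) (Q (suc m)) ⊛ G) n  ≡⟨ cong ((Q m ⊛ G) n +_) (⊛-shiftˡ (d * suc m) (Q (suc m)) G n) ⟩
  (Q m ⊛ G) n + shift (d * suc m) (Q (suc m) ⊛ G) n    ∎

-- Multisums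

quad : ℕ → ℕ → ℕ → ℕ
quad k c m = suc k * (m * pred m) + c * m

-- Already `m * pred m` is at least m - 1, so summands with m ≥ 2 + n do not reach the coefficient
-- of q^n.
≤-suc-quad : ∀ k c m → m ≤ suc (quad k c m)
≤-suc-quad k c zero    = z≤n
≤-suc-quad k c (suc m) = s≤s (≤-trans (m≤m+n m (m * m))
  (≤-trans (m≤m+n (suc m * m) (k * (suc m * m))) (m≤m+n (suc k * (suc m * m)) (c * suc m))))

quad-suc : ∀ k c m → quad k c (suc m) ≡ c + quad k (c + 2 * suc k) m
quad-suc k c zero    = base k c
  where
  base : ∀ k c → suc k * (1 * 0) + c * 1 ≡ c + (suc k * (0 * 0) + (c + 2 * suc k) * 0)
  base = solve-∀
quad-suc k c (suc m) = step k c m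
  where
  step : ∀ k c m → suc k * ((2 + m) * (1 + m)) + c * (2 + m) ≡
                   c + (suc k * ((1 + m) * m) + (c + 2 * suc k) * (1 + m))
  step = solve-∀

-- Σ_m q^(K m (m − 1) + c m) H m with K = suc k; the m-th summand has order at least m − 1.
Φ : ℕ → ℕ → (ℕ → PS) → PS
Φ k c H n = Σ< (2 + n) (λ m → shift (quad k c m) (H m) n)

quad-vanish : ∀ k c A {n} m → 2 + n ≤ m → shift (quad k c m) A n ≡ 0
quad-vanish k c A m 2+n≤m = shift-< A (≤-pred (≤-trans 2+n≤m (≤-suc-quad k c m)))

Φ-Σ< : ∀ k c H {n M} → 2 + n ≤ M → Φ k c H n ≡ Σ< M (λ m → shift (quad k c m) (H m) n)
Φ-Σ< k c H le = sym (Σ<-extend _ le (λ m → quad-vanish k c (H m) m))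

-- The number of terms in `Φ` depends on the coefficient index, which `shift e` lowers; a common
-- bound `M` lets the shift move inside the sum.
shift-Φ : ∀ k c H e {n M} → 2 + n ≤ M →
          shift e (Φ k c H) n ≡ Σ< M (λ m → shift e (shift (quad k c m) (H m)) n)
shift-Φ k c H zero            le = Φ-Σ< k c H le
shift-Φ k c H (suc e) {zero} {M} le = sym (Σ<-zero M (λ _ → refl))
shift-Φ k c H (suc e) {suc n} le = shift-Φ k c H e (<⇒≤ le)

Φ-cong : ∀ k c {H H′} → (∀ m → H m ≗ H′ m) → Φ k c H ≗ Φ k c H′
Φ-cong k c eq n = Σ<-cong (2 + n) (λ m → shift-cong (quad k c m) (eq m) n)

Φ-⊕ : ∀ k c H H′ → Φ k c (λ m → H m ⊕ H′ m) ≗ Φ k c H ⊕ Φ k c H′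
Φ-⊕ k c H H′ n = trans (Σ<-cong (2 + n) (λ m → shift-⊕ (quad k c m) (H m) (H′ m) n))
  (Σ<-+ (2 + n) (λ m → shift (quad k c m) (H m) n) (λ m → shift (quad k c m) (H′ m) n))

-- An exponent linear in m only changes the linear coefficient of `quad`.
Φ-shift : ∀ k c e d H → Φ k c (λ m → shift (e + d * m) (H m)) ≗ shift e (Φ k (c + d) H)
Φ-shift k c e d H n = trans (Σ<-cong (2 + n) term) (sym (shift-Φ k (c + d) H e ≤-refl))
  where
  exponent : ∀ K x c m e d → (K * x + c * m) + (e + d * m) ≡ e + (K * x + (c + d) * m)
  exponent = solve-∀
  term : ∀ m → shift (quad k c m) (shift (e + d * m) (H m)) n ≡ shift e (shift (quad k (c + d) m) (H m)) n
  term m = trans (shift-shift (quad k c m) (e + d * m) (H m) n)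
    (trans (shift-≡ (H m) (exponent (suc k) (m * pred m) c m e d) n)
           (sym (shift-shift e (quad k (c + d) m) (H m) n)))

Φ-head : ∀ k c H → Φ k c H ≗ H 0 ⊕ shift c (Φ k (c + 2 * suc k) (H ∘ suc))
Φ-head k c H n = cong₂ _+_ (shift-≡ (H 0) quad-0 n) (begin
  Σ< (1 + n) rest                                             ≡⟨ Σ<-extend rest (n≤1+n (1 + n)) (λ m le → quad-vanish k c (H (suc m)) (suc m) (s≤s le)) ⟨
  Σ< (2 + n) rest                                             ≡⟨ Σ<-cong (2 + n) term ⟩
  Σ< (2 + n) (λ m → shift c (shift (quad k c′ m) (H (suc m))) n) ≡⟨ shift-Φ k c′ (H ∘ suc) c ≤-refl ⟨
  shift c (Φ k c′ (H ∘ suc)) n                                ∎)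
  where
  c′ = c + 2 * suc k
  rest : ℕ → ℕ
  rest m = shift (quad k c (suc m)) (H (suc m)) n
  quad-0 : quad k c 0 ≡ 0
  quad-0 = cong₂ _+_ (*-zeroʳ (suc k)) (*-zeroʳ c)
  term : ∀ m → rest m ≡ shift c (shift (quad k c′ m) (H (suc m))) n
  term m = trans (shift-≡ (H (suc m)) (quad-suc k c m) n) (sym (shift-shift c (quad k c′ m) (H (suc m)) n))

-- In the variables m_l = s_l − s_{l+1} the exponent of L_p(a, b) is Σ s_l (s_l − 1) plus a linear form
-- whose coefficient of m_l is slope l p a b; with s_l (s_l − 1) in place of s_l² nothing is negative.
-- ser k p a b G is the Andrews–Gordon multisum of level k times G, and G collects the denominators in
-- the order in which denom multiplies them.
slope : ℕ → ℕ → ℕ → ℕ → ℕ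
slope l p a b = p * l + ((l ∸ a) + (l ∸ b))

gen : ℕ → (ℕ → PS) → ℕ → ℕ → ℕ → ℕ → PS
ser : ℕ → ℕ → ℕ → ℕ → PS → PS

gen k Q c p a b = Φ k c (λ m → ser k (p + 2 * m) a b (Q m))

ser zero    p a b G = G
ser (suc k) p a b G = gen k (λ m → invQPoch 1 m ⊛ G) (slope (suc k) p a b) p a b

ser-cong : ∀ k p a b {G G′} → G ≗ G′ → ser k p a b G ≗ ser k p a b G′
ser-cong zero    p a b eq = eq
ser-cong (suc k) p a b eq = Φ-cong k (slope (suc k) p a b)
  (λ m → ser-cong k (p + 2 * m) a b (⊛-cong {invQPoch 1 m} (λ _ → refl) eq))

ser-⊕ : ∀ k p a b G G′ → ser k p a b (G ⊕ G′) ≗ ser k p a b G ⊕ ser k p a b G′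
ser-⊕ zero    p a b G G′ n = refl
ser-⊕ (suc k) p a b G G′ n = trans
  (Φ-cong k c (λ m n′ → trans (ser-cong k (p + 2 * m) a b (⊛-distribˡ (invQPoch 1 m) G G′) n′)
                              (ser-⊕ k (p + 2 * m) a b (invQPoch 1 m ⊛ G) (invQPoch 1 m ⊛ G′) n′)) n)
  (Φ-⊕ k c (H G) (H G′) n)
  where
  c = slope (suc k) p a b
  H : PS → ℕ → PS
  H G m = ser k (p + 2 * m) a b (invQPoch 1 m ⊛ G)

ser-shift : ∀ k p a b e G → ser k p a b (shift e G) ≗ shift e (ser k p a b G)
ser-shift zero    p a b e G n = refl
ser-shift (suc k) p a b e G n = begin
  Φ k c (λ m → ser k (p + 2 * m) a b (invQPoch 1 m ⊛ shift e G)) n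
    ≡⟨ Φ-cong k c (λ m n′ → trans (ser-cong k (p + 2 * m) a b (⊛-shiftʳ e (invQPoch 1 m) G) n′)
         (trans (ser-shift k (p + 2 * m) a b e (invQPoch 1 m ⊛ G) n′) (shift-≡ (H m) (sym (+-identityʳ e)) n′))) n ⟩
  Φ k c (λ m → shift (e + 0 * m) (H m)) n  ≡⟨ Φ-shift k c e 0 H n ⟩
  shift e (Φ k (c + 0) H) n                ≡⟨ shift-cong e (λ n′ → cong (λ c → Φ k c H n′) (+-identityʳ c)) n ⟩
  shift e (Φ k c H) n                      ∎
  where
  c = slope (suc k) p a b
  H : ℕ → PS
  H m = ser k (p + 2 * m) a b (invQPoch 1 m ⊛ G)

-- Dependence of the multisums on their parameters

slope-+ : ∀ l p m a b → slope l (p + m) a b ≡ m * l + slope l p a b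
slope-+ l p m a b = arith p m l ((l ∸ a) + (l ∸ b))
  where
  arith : ∀ p m l x → (p + m) * l + x ≡ m * l + (p * l + x)
  arith = solve-∀

-- The parameters enter `ser k` only through the slopes at levels up to `k`, so different triples
-- may name the same series, and identities between such series reduce to comparing slopes.
record SameSlope (k p a b p′ a′ b′ : ℕ) : Set where
  constructor same
  field at : ∀ l → l ≤ k → slope l p a b ≡ slope l p′ a′ b′
open SameSlope

SameSlope-refl : ∀ {k p a b} → SameSlope k p a b p a b
SameSlope-refl = same (λ _ _ → refl)

SameSlope-pred : ∀ {k p a b p′ a′ b′} → SameSlope (suc k) p a b p′ a′ b′ → SameSlope k p a b p′ a′ b′
SameSlope-pred eq = same λ l le → at eq l (m≤n⇒m≤1+n le)

SameSlope-+ : ∀ {k p a b p′ a′ b′} m → SameSlope k p a b p′ a′ b′ → SameSlope k (p + m) a b (p′ + m) a′ b′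
SameSlope-+ {k} {p} {a} {b} {p′} {a′} {b′} m eq = same λ l le →
  trans (slope-+ l p m a b) (trans (cong (m * l +_) (at eq l le)) (sym (slope-+ l p′ m a′ b′)))

ser-ext : ∀ k {p a b p′ a′ b′} G → SameSlope k p a b p′ a′ b′ → ser k p a b G ≗ ser k p′ a′ b′ G
ser-ext zero    G eq n = refl
ser-ext (suc k) {p} {a} {b} {p′} {a′} {b′} G eq n = trans
  (Φ-cong k (slope (suc k) p a b) (λ m → ser-ext k (invQPoch 1 m ⊛ G)
     (SameSlope-+ (2 * m) (SameSlope-pred eq))) n)
  (cong (λ c → gen k (λ m → invQPoch 1 m ⊛ G) c p′ a′ b′ n) (at eq (suc k) ≤-refl))

gen-ext : ∀ k Q {c c′ p a b p′ a′ b′} → c ≡ c′ → SameSlope k p a b p′ a′ b′ →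
          gen k Q c p a b ≗ gen k Q c′ p′ a′ b′
gen-ext k Q {c} refl eq = Φ-cong k c (λ m → ser-ext k (Q m) (SameSlope-+ (2 * m) eq))

-- Multiplying the m-th summand by 1 - q^(d m) kills m = 0 and, for m ≥ 1, cancels the last
-- denominator factor, turning `Q m` into `Q (m − 1)`. Reindexing then raises `p` by 2 and `c` by
-- `2 * suc k`.
gen-telescope : ∀ k Q d → Telescopes d Q → ∀ c p a b →
  gen k Q c p a b ≗ gen k Q (c + d) p a b ⊕ shift c (gen k Q (c + 2 * suc k) (2 + p) a b)
gen-telescope k Q d tel c p a b n = begin
  Φ k c H n
    ≡⟨ Φ-head k c H n ⟩
  H 0 n + shift c (Φ k c₂ (H ∘ suc)) n
    ≡⟨ cong (H 0 n +_) (shift-cong c split n) ⟩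
  H 0 n + shift c (Φ k c₂ H₂ ⊕ shift d (Φ k (c₂ + d) (H ∘ suc))) n
    ≡⟨ cong (H 0 n +_) (shift-⊕ c (Φ k c₂ H₂) _ n) ⟩
  H 0 n + (shift c (Φ k c₂ H₂) n + shift c (shift d (Φ k (c₂ + d) (H ∘ suc))) n)
    ≡⟨ cong (λ x → H 0 n + (shift c (Φ k c₂ H₂) n + x)) (trans (shift-shift c d _ n)
         (shift-cong (c + d) (λ n′ → cong (λ e → Φ k e (H ∘ suc) n′) (swap c d (2 * suc k))) n)) ⟩
  H 0 n + (shift c (Φ k c₂ H₂) n + shift (c + d) (Φ k (c + d + 2 * suc k) (H ∘ suc)) n)
    ≡⟨ rotate (H 0 n) _ _ ⟩
  (H 0 n + shift (c + d) (Φ k (c + d + 2 * suc k) (H ∘ suc)) n) + shift c (Φ k c₂ H₂) n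
    ≡⟨ cong (_+ shift c (Φ k c₂ H₂) n) (Φ-head k (c + d) H n) ⟨
  Φ k (c + d) H n + shift c (Φ k c₂ H₂) n
    ∎
  where
  c₂ = c + 2 * suc k
  H H₂ : ℕ → PS
  H  m = ser k (p + 2 * m) a b (Q m)
  H₂ m = ser k (2 + p + 2 * m) a b (Q m)
  swap : ∀ c d x → c + x + d ≡ c + d + x
  swap = solve-∀
  rotate : ∀ x y z → x + (y + z) ≡ x + z + y
  rotate = solve-∀
  index : ∀ p m → p + 2 * suc m ≡ 2 + p + 2 * m
  index = solve-∀
  term : ∀ m → H (suc m) ≗ H₂ m ⊕ shift (d + d * m) (H (suc m))
  term m n′ = begin
    ser k (p + 2 * suc m) a b (Q (suc m)) n′
      ≡⟨ ser-cong k (p + 2 * suc m) a b (tel m) n′ ⟩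
    ser k (p + 2 * suc m) a b (Q m ⊕ shift (d * suc m) (Q (suc m))) n′
      ≡⟨ ser-⊕ k (p + 2 * suc m) a b (Q m) _ n′ ⟩
    ser k (p + 2 * suc m) a b (Q m) n′ + ser k (p + 2 * suc m) a b (shift (d * suc m) (Q (suc m))) n′
      ≡⟨ cong₂ _+_ (cong (λ x → ser k x a b (Q m) n′) (index p m))
           (trans (ser-shift k (p + 2 * suc m) a b (d * suc m) (Q (suc m)) n′)
                  (shift-≡ (H (suc m)) (*-suc d m) n′)) ⟩
    H₂ m n′ + shift (d + d * m) (H (suc m)) n′ ∎
  split : Φ k c₂ (H ∘ suc) ≗ Φ k c₂ H₂ ⊕ shift d (Φ k (c₂ + d) (H ∘ suc))
  split n′ = trans (Φ-cong k c₂ term n′) (trans (Φ-⊕ k c₂ H₂ (λ m → shift (d + d * m) (H (suc m))) n′)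
    (cong (Φ k c₂ H₂ n′ +_) (Φ-shift k c₂ d d (H ∘ suc) n′)))

-- Recursions for the multisums

-- At `b = k` the parameter `suc b` lies beyond every level and acts there like `k` itself, so only
-- the first parameter drops effectively. The factor `G` is arbitrary in order to carry the
-- denominators of the outer sums.
AG : ℕ → Set
AG k = ∀ p a b G → suc a ≤ b → b ≤ k →
  ser k p (suc a) b G ≗ ser k p a (suc b) G ⊕ shift (p * suc a) (ser k (suc p) (b ∸ suc a) k G)

-- The inner relation is applied at p + 2m in each summand; of its prefactor q^((p + 2m)(a + 1)) the
-- part depending on m moves into the slope `c`.
gen-AG : ∀ {k} → AG k → ∀ Q c p a b → suc a ≤ b → b ≤ k →
  gen k Q c p (suc a) b ≗
  gen k Q c p a (suc b) ⊕ shift (p * suc a) (gen k Q (c + 2 * suc a) (suc p) (b ∸ suc a) k)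
gen-AG {k} ag Q c p a b a<b b≤k n = begin
  gen k Q c p (suc a) b n
    ≡⟨ Φ-cong k c (λ m n′ → trans (ag (p + 2 * m) a b (Q m) a<b b≤k n′)
         (cong (ser k (p + 2 * m) a (suc b) (Q m) n′ +_) (shift-≡ (H m) (arith p m (suc a)) n′))) n ⟩
  Φ k c (λ m → ser k (p + 2 * m) a (suc b) (Q m) ⊕ shift (p * suc a + 2 * suc a * m) (H m)) n
    ≡⟨ Φ-⊕ k c (λ m → ser k (p + 2 * m) a (suc b) (Q m)) (λ m → shift (p * suc a + 2 * suc a * m) (H m)) n ⟩
  gen k Q c p a (suc b) n + Φ k c (λ m → shift (p * suc a + 2 * suc a * m) (H m)) n
    ≡⟨ cong (gen k Q c p a (suc b) n +_) (Φ-shift k c (p * suc a) (2 * suc a) H n) ⟩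
  gen k Q c p a (suc b) n + shift (p * suc a) (gen k Q (c + 2 * suc a) (suc p) (b ∸ suc a) k) n ∎
  where
  H : ℕ → PS
  H m = ser k (suc p + 2 * m) (b ∸ suc a) k (Q m)
  arith : ∀ p m a → (p + 2 * m) * a ≡ p * a + 2 * a * m
  arith = solve-∀

∸-unique : ∀ n a d → n ≡ a + d → n ∸ a ≡ d
∸-unique n a d refl = m+n∸m≡n a d

multisum : ℕ → (ℕ → PS) → ℕ → ℕ → ℕ → PS
multisum k Q p a b = gen k Q (slope (suc k) p a b) p a b

SameSlope-large : ∀ {k b b′} p a → k ≤ b → k ≤ b′ → SameSlope k p a b p a b′
SameSlope-large p a k≤b k≤b′ = same λ l l≤k → cong (λ x → p * l + ((l ∸ a) + x))
  (trans (m≤n⇒m∸n≡0 (≤-trans l≤k k≤b)) (sym (m≤n⇒m∸n≡0 (≤-trans l≤k k≤b′))))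

-- For `b ≤ k` the outer slope is unchanged when the first parameter drops by one and the second
-- rises by one. In the other summand the extra 2(a + 1) from `gen-AG` produces exactly the slope of
-- the new parameters.
multisum-step : ∀ {k} → AG k → ∀ Q p a b → suc a ≤ b → b ≤ k →
  multisum k Q p (suc a) b ≗
  multisum k Q p a (suc b) ⊕ shift (p * suc a) (multisum k Q (suc p) (b ∸ suc a) (suc k))
multisum-step {k} ag Q p a b a<b b≤k n = trans
  (gen-AG ag Q (slope (suc k) p (suc a) b) p a b a<b b≤k n)
  (cong₂ _+_
    (gen-ext k Q slope₁ SameSlope-refl n)
    (shift-cong (p * suc a) (gen-ext k Q slope₂ (SameSlope-large (suc p) (b ∸ suc a) ≤-refl (n≤1+n k))) n))
  where
  slope₁ : slope (suc k) p (suc a) b ≡ slope (suc k) p a (suc b)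
  slope₁ = cong (p * suc k +_) (trans (cong (k ∸ a +_) (+-∸-assoc 1 b≤k))
    (trans (+-suc (k ∸ a) (k ∸ b)) (cong (_+ (k ∸ b)) (sym (+-∸-assoc 1 (≤-trans (<⇒≤ a<b) b≤k))))))
  arith : ∀ p a y z → p * suc (suc a + y + z) + (suc y + z + suc z) + 2 * suc a ≡
                      suc p * suc (suc a + y + z) + (suc (suc a + z) + 0)
  arith = solve-∀
  e₁ : ∀ a y z → suc (suc a + y + z) ≡ suc a + (suc y + z)
  e₁ = solve-∀
  e₂ : ∀ a y z → suc (suc a + y + z) ≡ suc a + y + suc z
  e₂ = solve-∀
  e₃ : ∀ a y z → suc (suc a + y + z) ≡ y + suc (suc a + z)
  e₃ = solve-∀
  -- With b = a + 1 + y and k = a + 1 + y + z all truncated subtractions evaluate, and a polynomial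
  -- identity remains.
  slope₂′ : ∀ k b y z → b ≡ suc a + y → k ≡ suc a + y + z →
    slope (suc k) p (suc a) b + 2 * suc a ≡ slope (suc k) (suc p) (b ∸ suc a) (suc k)
  slope₂′ k b y z refl refl
    rewrite ∸-unique (suc k) (suc a) (suc y + z) (e₁ a y z)
          | ∸-unique (suc k) b (suc z) (e₂ a y z)
          | ∸-unique b (suc a) y refl
          | ∸-unique (suc k) y (suc (suc a + z)) (e₃ a y z)
          | n∸n≡0 (suc k)
          = arith p a y z
  slope₂ : slope (suc k) p (suc a) b + 2 * suc a ≡ slope (suc k) (suc p) (b ∸ suc a) (suc k)
  slope₂ = slope₂′ k b (b ∸ suc a) (k ∸ b) (sym (m+[n∸m]≡n a<b))
    (trans (sym (m+[n∸m]≡n b≤k)) (cong (_+ (k ∸ b)) (sym (m+[n∸m]≡n a<b))))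

shift-cong-≤ : ∀ e {n A B} → (∀ i → e + i ≤ n → A i ≡ B i) → shift e A n ≡ shift e B n
shift-cong-≤ zero            eq = eq _ ≤-refl
shift-cong-≤ (suc e) {zero}  eq = refl
shift-cong-≤ (suc e) {suc n} eq = shift-cong-≤ e (λ i le → eq i (s≤s le))

-- F and T satisfy the same pair of recursions with F and T exchanged; each step at p ≥ 1 gains
-- a power of q, so both are determined coefficientwise.
exchange-unique : (R : ℕ → ℕ → Set) → (∀ {x y} → R x y → R y x) → (F T base : ℕ → ℕ → ℕ → PS) →
  (∀ p x y → R x y → F p x y ≗ base p x y ⊕ shift (p * suc x) (T (suc p) y x)) →
  (∀ p x y → R x y → T p x y ≗ base p x y ⊕ shift (p * suc x) (F (suc p) y x)) →
  ∀ p x y → R x y → F p x y ≗ T p x y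
exchange-unique R R-sym F T base F-rec T-rec = main
  where
  step : ∀ p x y n → R x y → (∀ i → p * suc x + i ≤ n → F (suc p) y x i ≡ T (suc p) y x i) →
         F p x y n ≡ T p x y n
  step p x y n r eq = trans (F-rec p x y r n)
    (trans (cong (base p x y n +_) (sym (shift-cong-≤ (p * suc x) eq))) (sym (T-rec p x y r n)))
  bounded : ∀ N p x y n → n < N → R x y → F (suc p) x y n ≡ T (suc p) x y n
  bounded (suc N) p x y n (s≤s n≤N) r = step (suc p) x y n r
    (λ i le → bounded N (suc p) y x i (≤-trans (s≤s (m≤n+m i (x + p * suc x))) (≤-trans le n≤N)) (R-sym r))
  -- At p = 0 a step gains nothing, but it leads to p = 1, where `bounded` applies.
  main : ∀ p x y → R x y → F p x y ≗ T p x y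
  main p x y r n = step p x y n r (λ i _ → bounded (suc i) p y x i ≤-refl (R-sym r))

-- For `a < k`, telescoping followed by the inner relation at `b = k` expresses `F` through `T` with
-- the arguments exchanged, while `T` is by definition the same expression in `F`. Then
-- `exchange-unique` gives equality of `F` and `T`, which is the claim.
multisum-top : ∀ {k} → AG k → ∀ Q d → Telescopes d Q → ∀ p a → a ≤ k →
  multisum k Q p (suc a) (suc k) ≗
  gen k Q (slope (suc k) p (suc a) (suc k) + d) p a (suc k)
    ⊕ shift (p * suc a) (multisum k Q (suc p) (k ∸ a) (suc k))
multisum-top {k} ag Q d tel = main
  where
  K = suc k
  F base T : ℕ → ℕ → ℕ → PS
  F    p x y = multisum k Q p (suc x) K
  base p x y = gen k Q (slope K p (suc x) K + d) p x K
  T    p x y = base p x y ⊕ shift (p * suc x) (F (suc p) y x)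
  -- The exchange replaces the first parameter x + 1 by its complement y + 1; `R` says that the two
  -- add up to `K`.
  R : ℕ → ℕ → Set
  R x y = k ≡ x + suc y
  R-sym : ∀ {x y} → R x y → R y x
  R-sym {x} {y} r = trans r (trans (+-suc x y) (trans (cong suc (+-comm x y)) (sym (+-suc y x))))
  slope-R : ∀ p x y → R x y → slope K p (suc x) K ≡ p * K + suc y
  slope-R p x y r = cong (p * K +_) (trans (cong₂ _+_ (∸-unique k x (suc y) r) (n∸n≡0 k)) (+-identityʳ (suc y)))
  -- The prefactor of the telescoped sum splits into those of two successive exchanges, from x to y
  -- at `p` and back at `suc p`.
  exponent : ∀ p x y → R x y → slope K p (suc x) K ≡ p * suc x + suc p * suc y
  exponent p x y refl = trans (slope-R p x y refl) (arith p x y)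
    where
    arith : ∀ p x y → p * suc (x + suc y) + suc y ≡ p * suc x + suc p * suc y
    arith = solve-∀
  slope-T : ∀ p x y → R x y → slope K p (suc x) K + d + 2 * suc x ≡ slope K (suc p) (suc y) K + d
  slope-T p x y refl = trans (cong (λ z → z + d + 2 * suc x) (slope-R p x y refl))
    (trans (arith p x y d) (cong (_+ d) (sym (slope-R (suc p) y x (R-sym {x} {y} refl)))))
    where
    arith : ∀ p x y d → p * suc (x + suc y) + suc y + d + 2 * suc x ≡ suc p * suc (x + suc y) + suc x + d
    arith = solve-∀
  slope-2 : ∀ p x → slope K p x K + 2 * suc k ≡ slope K (2 + p) x K
  slope-2 p x = arith (p * K) ((K ∸ x) + (K ∸ K)) K
    where
    arith : ∀ u v w → u + v + 2 * w ≡ w + (w + u) + v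
    arith = solve-∀
  k∸sx : ∀ x y → R x y → k ∸ suc x ≡ y
  k∸sx x y r = ∸-unique k (suc x) y (trans r (+-suc x y))
  F-rec : ∀ p x y → R x y → F p x y ≗ base p x y ⊕ shift (p * suc x) (T (suc p) y x)
  F-rec p x y r n = begin
    F p x y n
      ≡⟨ gen-telescope k Q d tel c p (suc x) K n ⟩
    gen k Q (c + d) p (suc x) K n + shift c (gen k Q (c + 2 * suc k) (2 + p) (suc x) K) n
      ≡⟨ cong₂ _+_
           (trans (gen-ext k Q {c + d} refl (SameSlope-large p (suc x) (n≤1+n k) ≤-refl) n)
                  (gen-AG ag Q (c + d) p x k sx≤k ≤-refl n))
           (trans (shift-cong c (gen-ext k Q (slope-2 p (suc x)) SameSlope-refl) n)
                  (trans (shift-≡ (F (2 + p) x y) (exponent p x y r) n)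
                         (sym (shift-shift e (suc p * suc y) (F (2 + p) x y) n)))) ⟩
    (base p x y n + shift e (gen k Q (c + d + 2 * suc x) (suc p) (k ∸ suc x) k) n)
      + shift e (shift (suc p * suc y) (F (2 + p) x y)) n
      ≡⟨ cong (λ z → base p x y n + z + shift e (shift (suc p * suc y) (F (2 + p) x y)) n)
           (shift-cong e (λ n′ → trans
             (cong₂ (λ c z → gen k Q c (suc p) z k n′) (slope-T p x y r) (k∸sx x y r))
             (gen-ext k Q {slope K (suc p) (suc y) K + d} refl (SameSlope-large (suc p) y ≤-refl (n≤1+n k)) n′)) n) ⟩
    (base p x y n + shift e (base (suc p) y x) n) + shift e (shift (suc p * suc y) (F (2 + p) x y)) n
      ≡⟨ +-assoc (base p x y n) _ _ ⟩
    base p x y n + (shift e (base (suc p) y x) n + shift e (shift (suc p * suc y) (F (2 + p) x y)) n)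
      ≡⟨ cong (base p x y n +_) (shift-⊕ e (base (suc p) y x) _ n) ⟨
    base p x y n + shift e (T (suc p) y x) n ∎
    where
    c = slope K p (suc x) K
    e = p * suc x
    sx≤k : suc x ≤ k
    sx≤k = subst (suc x ≤_) (trans (sym (+-suc x y)) (sym r)) (s≤s (m≤m+n x y))
  F≗T : ∀ p x y → R x y → F p x y ≗ T p x y
  F≗T = exchange-unique R (λ {x} {y} → R-sym {x} {y}) F T base F-rec (λ _ _ _ _ _ → refl)
  -- `F` and `base` are constant in their last argument; 0 stands for any value.
  main : ∀ p a → a ≤ k → F p a 0 ≗ base p a 0 ⊕ shift (p * suc a) (multisum k Q (suc p) (k ∸ a) K)
  main p a a≤k n with m≤n⇒m<n∨m≡n a≤k
  ... | inj₁ a<k = trans (F≗T p a y r n) (cong (λ z → base p a y n + shift (p * suc a) (multisum k Q (suc p) z K) n)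
                     (sym (∸-unique k a (suc y) r)))
    where
    y = k ∸ suc a
    r : R a y
    r = sym (trans (+-suc a y) (m+[n∸m]≡n a<k))
  -- Here the complement of a + 1 = K is 0, so the exchange does not apply. Telescoping alone
  -- suffices, because the parameters (2 + p, K, K) and (1 + p, 0, K) have the same slopes.
  ... | inj₂ refl = trans (gen-telescope k Q d tel c p K K n) (cong₂ _+_
      (gen-ext k Q {c + d} refl slopes-kK n)
      (trans (shift-≡ (gen k Q (c + 2 * suc k) (2 + p) K K) c≡ n)
        (shift-cong (p * K) (λ n′ → trans
          (gen-ext k Q slope-0 slopes-0 n′) (cong (λ z → multisum k Q (suc p) z K n′) (sym (n∸n≡0 k)))) n)))
    where
    c = slope K p K K
    c≡ : c ≡ p * K
    c≡ = trans (cong (λ z → p * K + (z + z)) (n∸n≡0 k)) (+-identityʳ (p * K))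
    slopes-kK : SameSlope k p K K p k K
    slopes-kK = same λ l l≤k → cong (λ z → p * l + (z + (l ∸ K)))
      (trans (m≤n⇒m∸n≡0 (m≤n⇒m≤1+n l≤k)) (sym (m≤n⇒m∸n≡0 l≤k)))
    slopes-0 : SameSlope k (2 + p) K K (suc p) 0 K
    slopes-0 = same λ l l≤k → trans (cong (λ z → (2 + p) * l + (z + (l ∸ K))) (m≤n⇒m∸n≡0 (m≤n⇒m≤1+n l≤k)))
      (arith p l (l ∸ K))
      where
      arith : ∀ p l z → (2 + p) * l + z ≡ suc p * l + (l + z)
      arith = solve-∀
    slope-0 : c + 2 * suc k ≡ slope K (suc p) 0 K
    slope-0 = trans (cong (_+ 2 * K) c≡) (trans (arith p K) (cong (λ z → suc p * K + (K + z)) (sym (n∸n≡0 k))))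
      where
      arith : ∀ p K → p * K + 2 * K ≡ suc p * K + (K + 0)
      arith = solve-∀

-- Induction on the level. For `b = suc k` the denominators (q;q)_m give d = 1, and raising the
-- outer slope by 1 amounts to lowering the first parameter by one while the second passes beyond
-- the level.
AG-all : ∀ k → AG k
AG-all zero    p a .0 G () z≤n
AG-all (suc k) p a b G a<b b≤K n with m≤n⇒m<n∨m≡n b≤K
... | inj₁ (s≤s b≤k) = multisum-step (AG-all k) (λ m → invQPoch 1 m ⊛ G) p a b a<b b≤k n
... | inj₂ refl = trans (multisum-top (AG-all k) Q 1 (⊛-telescopes 1 (invQPoch 1) G (invQPoch-telescopes 0)) p a (≤-pred a<b) n)
    (cong (_+ shift (p * suc a) (multisum k Q (suc p) (k ∸ a) (suc k)) n)
      (gen-ext k Q slopes (SameSlope-large p a (n≤1+n k) (m≤n⇒m≤1+n (n≤1+n k))) n))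
  where
  Q = λ m → invQPoch 1 m ⊛ G
  slopes : slope (suc k) p (suc a) (suc k) + 1 ≡ slope (suc k) p a (2 + k)
  slopes = trans (arith (p * suc k) (k ∸ a) (k ∸ k)) (cong (p * suc k +_) (cong₂ _+_
    (sym (+-∸-assoc 1 (≤-pred a<b))) (trans (n∸n≡0 k) (sym (m≤n⇒m∸n≡0 (n≤1+n k))))))
    where
    arith : ∀ u v w → u + (v + w) + 1 ≡ u + (suc v + w)
    arith = solve-∀

-- At `a = 0` the summand `l ∸ a` of the slope is l and merges with p l; on the right `l ∸ suc k`
-- vanishes.
multisum-zero : ∀ k Q p b → multisum k Q p 0 b ≗ multisum k Q (suc p) b (suc k)
multisum-zero k Q p b = gen-ext k Q (SameSlope.at slopes (suc k) ≤-refl) (SameSlope-pred slopes)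
  where
  arith : ∀ p l x → p * l + (l + x) ≡ suc p * l + (x + 0)
  arith = solve-∀
  slopes : SameSlope (suc k) p 0 b (suc p) b (suc k)
  slopes = same λ l l≤K → trans (arith p l (l ∸ b))
    (cong (λ z → suc p * l + ((l ∸ b) + z)) (sym (m≤n⇒m∸n≡0 l≤K)))

-- The denominators (q^2;q^2)_m give d = 2: the outer slope gains 1 from lowering the first
-- parameter and 1 from lowering the second to `k`. The inner sums do not see the second change.
bressoud-top : ∀ k p a → a ≤ k → multisum k (invQPoch 2) p (suc a) (suc k) ≗
  multisum k (invQPoch 2) p a k ⊕ shift (p * suc a) (multisum k (invQPoch 2) (suc p) (k ∸ a) (suc k))
bressoud-top k p a a≤k n = trans
  (multisum-top (AG-all k) (invQPoch 2) 2 (invQPoch-telescopes 1) p a a≤k n)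
  (cong (_+ shift (p * suc a) (multisum k (invQPoch 2) (suc p) (k ∸ a) (suc k)) n)
    (gen-ext k (invQPoch 2) slopes (SameSlope-large p a (n≤1+n k) ≤-refl) n))
  where
  slopes : slope (suc k) p (suc a) (suc k) + 2 ≡ slope (suc k) p a k
  slopes = trans (cong (λ z → p * suc k + ((k ∸ a) + z) + 2) (n∸n≡0 k))
    (trans (arith (p * suc k) (k ∸ a)) (cong₂ (λ y z → p * suc k + (y + z))
      (sym (+-∸-assoc 1 a≤k)) (sym (m+n∸n≡m 1 k))))
    where
    arith : ∀ u v → u + (v + 0) + 2 ≡ u + (suc v + 1)
    arith = solve-∀

-- Coefficients below q^p

-- Every summand with m ≥ 1 is divisible by q^c.
gen-low : ∀ k Q c p a b {n} → n < c → gen k Q c p a b n ≡ ser k p a b (Q 0) n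
gen-low k Q c p a b {n} n<c = trans (Φ-head k c H n)
  (trans (cong (H 0 n +_) (shift-< (Φ k (c + 2 * suc k) (H ∘ suc)) n<c))
    (trans (+-identityʳ (H 0 n)) (cong (λ p → ser k p a b (Q 0) n) (+-identityʳ p))))
  where
  H : ℕ → PS
  H m = ser k (p + 2 * m) a b (Q m)

p≤slope : ∀ k p a b → p ≤ slope (suc k) p a b
p≤slope k p a b = ≤-trans (m≤m*n p (suc k)) (m≤m+n (p * suc k) _)

ser-low : ∀ k p a b G {n} → n < p → ser k p a b G n ≡ G n
ser-low zero    p a b G n<p = refl
ser-low (suc k) p a b G {n} n<p = trans
  (gen-low k (λ m → invQPoch 1 m ⊛ G) (slope (suc k) p a b) p a b (≤-trans n<p (p≤slope k p a b)))
  (trans (ser-low k p a b (one ⊛ G) n<p) (⊛-identityˡ G n))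

multisum-low : ∀ k Q p a b {n} → n < p → multisum k Q p a b n ≡ Q 0 n
multisum-low k Q p a b n<p = trans
  (gen-low k Q (slope (suc k) p a b) p a b (≤-trans n<p (p≤slope k p a b))) (ser-low k p a b (Q 0) n<p)

-- Frequency sequences

parity-double : ∀ x y → parity (x + (y + y)) ≡ parity x
parity-double x y = trans (ℙₚ.+-homo-+ x (y + y))
  (trans (cong (parity x ℙ.+_) (trans (ℙₚ.+-homo-+ y y) (ℙₚ.p+p≡0ℙ (parity y)))) (ℙₚ.+-identityʳ (parity x)))

record Even (n : ℕ) : Set where
  constructor mkEven
  field parity≡0 : parity n ≡ 0ℙ
open Even

Even-+double : ∀ {x z} y → z ≡ x + (y + y) → Even x → Even z
Even-+double {x} y refl (mkEven ev) = mkEven (trans (parity-double x y) ev)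

Even-−double : ∀ {x z} y → z ≡ x + (y + y) → Even z → Even x
Even-−double {x} y refl (mkEven ev) = mkEven (trans (sym (parity-double x y)) ev)

-- The congruence modulo 2 to a + b is stated as evenness of a sum, so that changes of the
-- parameters amount to adding or removing doubles.
record Adm (K a b : ℕ) (f : ℕ → ℕ) : Set where
  constructor adm
  field
    adj  : ∀ i → f i + f (suc i) ≤ K
    hd   : f 0 ≤ a
    pair : f 0 + f 0 + f 1 ≤ a + b
    even : ∀ i → f i + f (suc i) ≡ K → Even (i * f i + suc i * f (suc i) + (a + b))
open Adm

-- Lowering the index by one costs u + v, which is K where the parity condition applies. Up to the
-- double of a, the parameter sum a + b with b = a + y thus becomes y + K, as needed for the tail.
tail-arith : ∀ i u v a y → suc i * u + suc (suc i) * v + (a + (a + y)) ≡ (i * u + suc i * v + (y + (u + v))) + (a + a)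
tail-arith = solve-∀

Adm-cons : ∀ {K a b} (f : ℕ → ℕ) → f 0 ≡ a → a ≤ b → b ≤ K → Adm K (b ∸ a) K (f ∘ suc) → Adm K a b f
Adm-cons {K} {.(f 0)} {b} f refl a≤b b≤K ad = adm
  (λ { zero → ≤-trans sum≤b b≤K ; (suc i) → adj ad i })
  ≤-refl
  (subst (_≤ f 0 + b) (sym (+-assoc (f 0) (f 0) (f 1))) (+-monoʳ-≤ (f 0) sum≤b))
  -- If f_0 + f_1 = K, then f_0 + f_1 ≤ b ≤ K forces equality throughout, and the number in question
  -- is 2b.
  (λ { zero eq → Even-+double b (begin
         1 * f 1 + (f 0 + b)   ≡⟨ arith (f 1) (f 0) b ⟩
         (f 0 + f 1) + b       ≡⟨ cong (_+ b) (≤-antisym sum≤b (≤-trans b≤K (≤-reflexive (sym eq)))) ⟩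
         0 + (b + b)           ∎) (mkEven {0} refl)
     ; (suc i) eq → Even-+double (f 0)
         (trans (cong (λ b → suc i * f (suc i) + suc (suc i) * f (2 + i) + (f 0 + b)) (sym (m+[n∸m]≡n a≤b)))
           (trans (tail-arith i (f (suc i)) (f (2 + i)) (f 0) (b ∸ f 0))
             (cong (λ K → i * f (suc i) + suc i * f (2 + i) + ((b ∸ f 0) + K) + (f 0 + f 0)) eq)))
         (even ad i eq) })
  where
  sum≤b : f 0 + f 1 ≤ b
  sum≤b = ≤-trans (+-monoʳ-≤ (f 0) (hd ad)) (≤-reflexive (m+[n∸m]≡n a≤b))
  arith : ∀ v a b → 1 * v + (a + b) ≡ (a + v) + b
  arith = solve-∀

Adm-uncons : ∀ {K a b} (f : ℕ → ℕ) → f 0 ≡ a → a ≤ b → Adm K a b f → Adm K (b ∸ a) K (f ∘ suc)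
Adm-uncons {K} {.(f 0)} {b} f refl a≤b ad = adm
  (adj ad ∘ suc)
  f1≤
  -- The second parameter of the tail is `K`, so its pair bound is the sum of f_1 ≤ b - a and f_1 +
  -- f_2 ≤ K.
  (subst (_≤ b ∸ f 0 + K) (sym (+-assoc (f 1) (f 1) (f 2))) (+-mono-≤ f1≤ (adj ad 1)))
  (λ i eq → Even-−double (f 0)
         (trans (cong (λ b → suc i * f (suc i) + suc (suc i) * f (2 + i) + (f 0 + b)) (sym (m+[n∸m]≡n a≤b)))
           (trans (tail-arith i (f (suc i)) (f (2 + i)) (f 0) (b ∸ f 0))
             (cong (λ K → i * f (suc i) + suc i * f (2 + i) + ((b ∸ f 0) + K) + (f 0 + f 0)) eq)))
         (even ad (suc i) eq))
  where
  f1≤ : f 1 ≤ b ∸ f 0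
  f1≤ = +-cancelˡ-≤ (f 0) (f 1) (b ∸ f 0) (subst (f 0 + f 1 ≤_) (sym (m+[n∸m]≡n a≤b))
    (+-cancelˡ-≤ (f 0) (f 0 + f 1) b (subst (_≤ f 0 + b) (+-assoc (f 0) (f 0) (f 1)) (pair ad))))

-- `pair` and `even` see only the sum of the two parameters, which stays fixed.
Adm-lower : ∀ {K a b f} → f 0 ≤ a → Adm K (suc a) b f → Adm K a (suc b) f
Adm-lower {K} {a} {b} {f} f0≤a ad = adm (adj ad) f0≤a (subst (f 0 + f 0 + f 1 ≤_) (sym (+-suc a b)) (pair ad))
  (λ i eq → subst (λ z → Even (i * f i + suc i * f (suc i) + z)) (sym (+-suc a b)) (even ad i eq))

Adm-raise : ∀ {K a b f} → Adm K a (suc b) f → Adm K (suc a) b f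
Adm-raise {K} {a} {b} {f} ad = adm (adj ad) (m≤n⇒m≤1+n (hd ad)) (subst (f 0 + f 0 + f 1 ≤_) (+-suc a b) (pair ad))
  (λ i eq → subst (λ z → Even (i * f i + suc i * f (suc i) + z)) (+-suc a b) (even ad i eq))

top-arith : ∀ x a k → x + (suc a + suc k) ≡ (x + (a + k)) + (1 + 1)
top-arith = solve-∀

-- The parameter sum drops by 2, so `pair` has to be sharpened. This could fail only if f_0 = a and
-- f_0 + f_1 = K, and then the parity condition at i = 0 would require 1 + 2K to be even.
Adm-lower-top : ∀ {k a f} → f 0 ≤ a → Adm (suc k) (suc a) (suc k) f → Adm (suc k) a k f
Adm-lower-top {k} {a} {f} f0≤a ad = adm (adj ad) f0≤a pair′
  (λ i eq → Even-−double 1 (top-arith (i * f i + suc i * f (suc i)) a k) (even ad i eq))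
  where
  odd : f 0 ≡ a → f 0 + f 1 ≡ suc k → ¬ Even (1 * f 1 + (suc a + suc k))
  odd refl eq (mkEven ev) = contradiction (trans (sym (parity-double 1 (suc k))) (trans (cong parity (sym (begin
    1 * f 1 + (suc (f 0) + suc k)   ≡⟨ arith (f 1) (f 0) (suc k) ⟩
    1 + ((f 0 + f 1) + suc k)       ≡⟨ cong (λ z → 1 + (z + suc k)) eq ⟩
    1 + (suc k + suc k)             ∎))) ev)) λ ()
    where
    arith : ∀ v a K → 1 * v + (suc a + K) ≡ 1 + ((a + v) + K)
    arith = solve-∀
  pair′ : f 0 + f 0 + f 1 ≤ a + k
  pair′ rewrite +-assoc (f 0) (f 0) (f 1) with m≤n⇒m<n∨m≡n (adj ad 0)
  ... | inj₁ (s≤s sum≤k) = +-mono-≤ f0≤a sum≤k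
  ... | inj₂ sum≡K with m≤n⇒m<n∨m≡n f0≤a
  ...   | inj₁ f0<a = subst (λ z → f 0 + z ≤ a + k) (sym sum≡K) (subst (_≤ a + k) (sym (+-suc (f 0) k)) (+-monoˡ-≤ k f0<a))
  ...   | inj₂ f0≡a = contradiction (even ad 0 sum≡K) (odd f0≡a sum≡K)

Adm-raise-top : ∀ {k a f} → Adm (suc k) a k f → Adm (suc k) (suc a) (suc k) f
Adm-raise-top {k} {a} {f} ad = adm (adj ad) (m≤n⇒m≤1+n (hd ad))
  (≤-trans (pair ad) (+-mono-≤ (n≤1+n a) (n≤1+n k)))
  (λ i eq → Even-+double 1 (top-arith (i * f i + suc i * f (suc i)) a k) (even ad i eq))

-- Finite enumerations

Enum : {A : Set} → (A → Set) → ℕ → Set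
Enum {A} P c = Σ (List A) λ L → Unique L × (∀ v → (v ∈ L → P v) × (P v → v ∈ L)) × c ≡ length L

Enum-⇔ : ∀ {A : Set} {P Q : A → Set} {c d} → (∀ v → P v → Q v) → (∀ v → Q v → P v) → d ≡ c → Enum P c → Enum Q d
Enum-⇔ to from eq (L , u , mem , len) =
  L , u , (λ v → to v ∘ proj₁ (mem v) , proj₂ (mem v) ∘ from v) , trans eq len

Enum-∅ : ∀ {A : Set} {P : A → Set} → (∀ v → ¬ P v) → Enum P 0
Enum-∅ none = [] , AllPairs.[] , (λ v → (λ ()) , λ p → contradiction p (none v)) , refl

Enum-⊎ : ∀ {A : Set} {P Q : A → Set} {c d} → (∀ v → P v → ¬ Q v) → Enum P c → Enum Q d →
         Enum (λ v → P v ⊎ Q v) (c + d)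
Enum-⊎ {P = P} {Q} disj (L , u , mem , len) (M , w , nem , men) =
  L ++ M , Unique.++⁺ u w (λ {v} (x , y) → disj v (proj₁ (mem v) x) (proj₁ (nem v) y)) ,
  (λ v → to v , λ { (inj₁ p) → ∈-++⁺ˡ (proj₂ (mem v) p) ; (inj₂ q) → ∈-++⁺ʳ L (proj₂ (nem v) q) }) ,
  trans (cong₂ _+_ len men) (sym (length-++ L))
  where
  to : ∀ v → v ∈ L ++ M → P v ⊎ Q v
  to v x with ∈-++⁻ L x
  ... | inj₁ y = inj₁ (proj₁ (mem v) y)
  ... | inj₂ y = inj₂ (proj₁ (nem v) y)

Enum-map-∷ : ∀ {ℓ} {R : Vec ℕ ℓ → Set} {c} x → Enum R c →
             Enum (λ (v : Vec ℕ (suc ℓ)) → head v ≡ x × R (tail v)) c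
Enum-map-∷ {R = R} x (L , u , mem , len) = map (x ∷_) L , Unique.map⁺ ∷-injectiveʳ u ,
  (λ v → to v , from v) , trans len (sym (length-map (x ∷_) L))
  where
  to : ∀ v → v ∈ map (x ∷_) L → head v ≡ x × R (tail v)
  to v y with ∈-map⁻ (x ∷_) y
  ... | w , w∈ , refl = refl , proj₁ (mem w) w∈
  from : ∀ v → head v ≡ x × R (tail v) → v ∈ map (x ∷_) L
  from (.x ∷ w) (refl , r) = ∈-map⁺ (x ∷_) (proj₂ (mem w) r)

-- The entry at position i counts p + i times, so that removing f_0 raises `p` by one, matching the
-- substitution x ↦ x q^p.
weight : ∀ {ℓ} → ℕ → Vec ℕ ℓ → ℕ
weight p []      = 0
weight p (x ∷ v) = p * x + weight (suc p) v

Enum-cons : ∀ {ℓ} {R : Vec ℕ ℓ → Set} (C : PS) x p n →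
  (∀ n′ → n′ ≤ n → Enum (λ v → weight (suc p) v ≡ n′ × R v) (C n′)) →
  Enum (λ (v : Vec ℕ (suc ℓ)) → weight p v ≡ n × head v ≡ x × R (tail v)) (shift (p * x) C n)
Enum-cons C x p n en with p * x ≤? n
... | yes le = Enum-⇔
  (λ { (.x ∷ v) (refl , eq , r) → trans (cong (p * x +_) eq) (m+[n∸m]≡n le) , refl , r })
  (λ { (.x ∷ v) (eq , refl , r) → refl , sym (∸-unique n (p * x) _ (sym eq)) , r })
  (shift-≥ C le) (Enum-map-∷ x (en (n ∸ p * x) (m∸n≤m n (p * x))))
... | no ¬le = subst (Enum _) (sym (shift-< C (≰⇒> ¬le)))
  (Enum-∅ (λ { (.x ∷ v) (eq , refl , _) → ¬le (≤-trans (m≤m+n (p * x) _) (≤-reflexive eq)) }))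

-- Counting admissible sequences by their first entry

module _ (k : ℕ) where
  private
    K = suc k
    B : ℕ → ℕ → ℕ → PS
    B = multisum k (invQPoch 2)

  Counted : ∀ ℓ → ℕ → ℕ → ℕ → ℕ → Set
  Counted ℓ p a b n = Enum (λ (v : Vec ℕ ℓ) → weight p v ≡ n × Adm K a b (freq v)) (B p a b n)

  counted-[] : ∀ p a b n → n < p → Counted 0 p a b n
  counted-[] p a b zero n<p = [ [] ] , All.[] AllPairs.∷ AllPairs.[] ,
    -- The parity condition is vacuous for the zero sequence, since `K` is positive.
    (λ { [] → (λ _ → refl , adm (λ _ → z≤n) z≤n z≤n (λ _ ())) , (λ _ → here refl) }) ,
    multisum-low k (invQPoch 2) p a b n<p
  counted-[] p a b (suc n) n<p = subst (Enum _) (sym (multisum-low k (invQPoch 2) p a b n<p))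
    (Enum-∅ λ { [] (() , _) })

  counted-head : ∀ {ℓ p a b n} → a ≤ b → b ≤ K → (∀ n′ → n′ ≤ n → Counted ℓ (suc p) (b ∸ a) K n′) →
    Enum (λ (v : Vec ℕ (suc ℓ)) → weight p v ≡ n × head v ≡ a × Adm K a b (freq v))
         (shift (p * a) (B (suc p) (b ∸ a) K) n)
  counted-head {p = p} {a} {b} {n} a≤b b≤K en = Enum-⇔
    (λ { (x ∷ v) (w , h , ad) → w , h , Adm-cons (freq (x ∷ v)) h a≤b b≤K ad })
    (λ { (x ∷ v) (w , h , ad) → w , h , Adm-uncons (freq (x ∷ v)) h a≤b ad })
    refl (Enum-cons (B (suc p) (b ∸ a) K) a p n en)

  -- The sequences with f_0 ≤ a and those with f_0 = a + 1 give the two summands. Both recursions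
  -- are covered: `b′` is `suc b` below the top and `k` at `b = K`.
  counted-suc : ∀ {ℓ p a b b′ n} →
    (∀ {f} → f 0 ≤ a → Adm K (suc a) b f → Adm K a b′ f) → (∀ {f} → Adm K a b′ f → Adm K (suc a) b f) →
    B p (suc a) b n ≡ B p a b′ n + shift (p * suc a) (B (suc p) (b ∸ suc a) K) n →
    suc a ≤ b → b ≤ K → (∀ n′ → n′ ≤ n → Counted ℓ (suc p) (b ∸ suc a) K n′) →
    Counted (suc ℓ) p a b′ n → Counted (suc ℓ) p (suc a) b n
  counted-suc {ℓ} {p} {a} {b} {b′} {n} lower raise eq a<b b≤K en-head en-rest = Enum-⇔
    (λ { v (inj₁ (w , ad)) → w , raise ad ; v (inj₂ (w , _ , ad)) → w , ad })
    split eq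
    (Enum-⊎ (λ { (x ∷ v) (_ , ad) (_ , refl , _) → 1+n≰n (hd ad) }) en-rest (counted-head a<b b≤K en-head))
    where
    split : ∀ v → weight p v ≡ n × Adm K (suc a) b (freq v) →
      (weight p v ≡ n × Adm K a b′ (freq v)) ⊎ (weight p v ≡ n × head v ≡ suc a × Adm K (suc a) b (freq v))
    split (x ∷ v) (w , ad) with m≤n⇒m<n∨m≡n (hd ad)
    ... | inj₁ (s≤s x≤a) = inj₁ (w , lower x≤a ad)
    ... | inj₂ x≡        = inj₂ (w , x≡ , ad)

  -- By n < p + ℓ, entries beyond the first ℓ would have weight above n, so vectors of length ℓ lose
  -- nothing; removing the first entry preserves p + ℓ. The outer induction is on ℓ, the inner one
  -- `go` on a.
  counted : ∀ ℓ p a b n → n < p + ℓ → a ≤ b → b ≤ K → Counted ℓ p a b n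
  counted zero    p a b n n<p a≤b b≤K = counted-[] p a b n (subst (n <_) (+-identityʳ p) n<p)
  counted (suc ℓ) p a b n n<pℓ a≤b b≤K = go a b a≤b b≤K
    where
    tails : ∀ a′ → a′ ≤ K → ∀ n′ → n′ ≤ n → Counted ℓ (suc p) a′ K n′
    tails a′ a′≤K n′ n′≤n = counted ℓ (suc p) a′ K n′ (≤-trans (s≤s n′≤n) (subst (n <_) (+-suc p ℓ) n<pℓ)) a′≤K ≤-refl
    go : ∀ a b → a ≤ b → b ≤ K → Counted (suc ℓ) p a b n
    go zero    b a≤b b≤K = Enum-⇔
      (λ v (w , _ , ad) → w , ad)
      (λ { (x ∷ v) (w , ad) → w , n≤0⇒n≡0 (hd ad) , ad })
      (trans (multisum-zero k (invQPoch 2) p b n) (shift-≡ {0} (B (suc p) b K) (sym (*-zeroʳ p)) n))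
      (counted-head z≤n b≤K (tails b b≤K))
    go (suc a) b a<b b≤K with m≤n⇒m<n∨m≡n b≤K
    ... | inj₁ (s≤s b≤k) = counted-suc Adm-lower Adm-raise
      (multisum-step (AG-all k) (invQPoch 2) p a b a<b b≤k n) a<b b≤K
      (tails (b ∸ suc a) (≤-trans (m∸n≤m b (suc a)) b≤K)) (go a (suc b) (m≤n⇒m≤1+n (<⇒≤ a<b)) (s≤s b≤k))
    ... | inj₂ refl = counted-suc Adm-lower-top Adm-raise-top
      (bressoud-top k p a (≤-pred a<b) n) a<b ≤-refl
      (tails (k ∸ a) (≤-trans (m∸n≤m k a) (n≤1+n k))) (go a k (≤-pred a<b) (n≤1+n k))

-- Conditions of the theorem and admissibility

size≡weight : ∀ {m} (v : Vec ℕ m) → size v ≡ weight 0 v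
size≡weight v = from 0 v id (λ _ → refl)
  where
  from : ∀ {m} p (v : Vec ℕ m) (g : ℕ → ℕ) → (∀ i → g i ≡ p + i) →
    sum (zipWith _*_ (applyUpTo g (length (toList v))) (toList v)) ≡ weight p v
  from p []      g eq = refl
  from p (x ∷ v) g eq = cong₂ _+_ (cong (_* x) (trans (eq 0) (+-identityʳ p)))
    (from (suc p) v (g ∘ suc) (λ i → trans (eq (suc i)) (+-suc p i)))

%2-parity : ∀ m n → (m % 2 ≡ n % 2 → parity m ≡ parity n) × (parity m ≡ parity n → m % 2 ≡ n % 2)
%2-parity 0 0 = (λ _ → refl) , (λ _ → refl)
%2-parity 0 1 = (λ ()) , (λ ())
%2-parity 1 0 = (λ ()) , (λ ())
%2-parity 1 1 = (λ _ → refl) , (λ _ → refl)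
%2-parity (suc (suc m)) n = %2-parity m n
%2-parity 0 (suc (suc n)) = %2-parity 0 n
%2-parity 1 (suc (suc n)) = %2-parity 1 n

module _ {j r K} (j+r≤K : j + r ≤ K) where
  private
    b = K ∸ r
    d = (K + r) ∸ j

    r≤K : r ≤ K
    r≤K = ≤-trans (m≤n+m r j) j+r≤K

    d-even : Even (d + (j + b))
    d-even = Even-+double (b + r) (begin
      d + (j + b)            ≡⟨ arith₁ d j b ⟩
      (j + d) + b            ≡⟨ cong (_+ b) (m+[n∸m]≡n (≤-trans (m≤m+n j r) (≤-trans j+r≤K (m≤m+n K r)))) ⟩
      (K + r) + b            ≡⟨ cong (λ z → z + r + b) (m∸n+n≡m r≤K) ⟨
      (b + r + r) + b        ≡⟨ arith₂ b r ⟩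
      0 + ((b + r) + (b + r)) ∎) (mkEven {0} refl)
      where
      arith₁ : ∀ d j b → d + (j + b) ≡ (j + d) + b
      arith₁ = solve-∀
      arith₂ : ∀ b r → (b + r + r) + b ≡ 0 + ((b + r) + (b + r))
      arith₂ = solve-∀

    to-even : ∀ x → x % 2 ≡ d % 2 → Even (x + (j + b))
    to-even x eq = mkEven (trans (ℙₚ.+-homo-+ x (j + b))
      (trans (cong (ℙ._+ parity (j + b)) (proj₁ (%2-parity x d) eq))
        (trans (sym (ℙₚ.+-homo-+ d (j + b))) (parity≡0 d-even))))

    from-even : ∀ x → Even (x + (j + b)) → x % 2 ≡ d % 2
    from-even x (mkEven ev) = proj₂ (%2-parity x d) (ℙₚ.+-cancelʳ-≡ (parity (j + b)) (parity x) (parity d)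
      (trans (sym (ℙₚ.+-homo-+ x (j + b))) (trans ev (trans (sym (parity≡0 d-even)) (ℙₚ.+-homo-+ d (j + b))))))

  -- The truncated subtraction is a maximum, so the single bound amounts to the two bounds f_0 ≤ j
  -- and 2 f_0 + f_1 ≤ j + b.
  Valid⇒Adm : ∀ {f} → Valid j r K f → Adm K j b f
  Valid⇒Adm {f} (ad , bd , par) = adm ad (≤-trans (m≤m+n (f 0) _) bd)
    (subst (_≤ j + b) (sym (+-assoc (f 0) (f 0) (f 1)))
      (≤-trans (+-monoʳ-≤ (f 0) (m≤n+m∸n (f 0 + f 1) b))
        (≤-trans (≤-reflexive (arith (f 0) b (f 0 + f 1 ∸ b))) (+-monoˡ-≤ b bd))))
    (λ i eq → to-even (i * f i + suc i * f (suc i)) (par i eq))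
    where
    arith : ∀ x b y → x + (b + y) ≡ x + y + b
    arith = solve-∀

  Adm⇒Valid : ∀ {f} → Adm K j b f → Valid j r K f
  Adm⇒Valid {f} ad = adj ad , bound , λ i eq → from-even (i * f i + suc i * f (suc i)) (even ad i eq)
    where
    bound : f 0 + ((f 0 + f 1) ∸ b) ≤ j
    bound with ≤-total (f 0 + f 1) b
    ... | inj₁ le = subst (_≤ j) (sym (trans (cong (f 0 +_) (m≤n⇒m∸n≡0 le)) (+-identityʳ (f 0)))) (hd ad)
    ... | inj₂ ge = +-cancelʳ-≤ b _ _ (subst (_≤ j + b)
      (trans (+-assoc (f 0) (f 0) (f 1)) (trans (cong (f 0 +_) (sym (m∸n+n≡m ge))) (sym (+-assoc (f 0) _ b)))) (pair ad))

-- The truncated multisum over tuples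

Σ<-swap : ∀ M M′ (f : ℕ → ℕ → ℕ) → Σ< M (λ x → Σ< M′ (f x)) ≡ Σ< M′ (λ y → Σ< M (λ x → f x y))
Σ<-swap zero    M′ f = sym (Σ<-zero M′ (λ _ → refl))
Σ<-swap (suc M) M′ f = trans (cong (Σ< M′ (f 0) +_) (Σ<-swap M M′ (f ∘ suc)))
  (sym (Σ<-+ M′ (f 0) (λ y → Σ< M (λ x → f (suc x) y))))

Σ<-drop : ∀ y M f → (∀ x → x < y → f x ≡ 0) → Σ< (y + M) f ≡ Σ< M (λ m → f (y + m))
Σ<-drop zero    M f z = refl
Σ<-drop (suc y) M f z = trans (cong (_+ Σ< (y + M) (f ∘ suc)) (z 0 (s≤s z≤n)))
  (Σ<-drop y M (f ∘ suc) (λ x lt → z (suc x) (s≤s lt)))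

sum-concatMap : ∀ {A B : Set} (h : B → ℕ) (f : A → List B) xs →
  sum (map h (concatMap f xs)) ≡ sum (map (λ x → sum (map h (f x))) xs)
sum-concatMap h f []       = refl
sum-concatMap h f (x ∷ xs) = begin
  sum (map h (f x ++ concatMap f xs))             ≡⟨ cong sum (map-++ h (f x) (concatMap f xs)) ⟩
  sum (map h (f x) ++ map h (concatMap f xs))     ≡⟨ sum-++ (map h (f x)) _ ⟩
  sum (map h (f x)) + sum (map h (concatMap f xs)) ≡⟨ cong (sum (map h (f x)) +_) (sum-concatMap h f xs) ⟩
  sum (map h (f x)) + sum (map (λ x → sum (map h (f x))) xs) ∎

Σtuples : ℕ → ℕ → (List ℕ → ℕ) → ℕ
Σtuples k N h = sum (map h (tuples k N))

Σtuples-∷ : ∀ k N h → Σtuples (suc k) N h ≡ Σ< (suc N) (λ x → Σtuples k N (λ t → h (x ∷ t)))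
Σtuples-∷ k N h = trans (sum-concatMap h (λ x → map (x ∷_) (tuples k N)) (upTo (suc N)))
  (trans (sum-applyUpTo (λ x → sum (map h (map (x ∷_) (tuples k N)))) id (suc N))
         (Σ<-cong (suc N) (λ x → cong sum (sym (map-∘ {g = h} {f = x ∷_} (tuples k N))))))

Σtuples-cong : ∀ k N h h′ → (∀ t → length t ≡ k → h t ≡ h′ t) → Σtuples k N h ≡ Σtuples k N h′
Σtuples-cong zero    N h h′ eq = cong (_+ 0) (eq [] refl)
Σtuples-cong (suc k) N h h′ eq = trans (Σtuples-∷ k N h)
  (trans (Σ<-cong (suc N) (λ x → Σtuples-cong k N (λ t → h (x ∷ t)) (λ t → h′ (x ∷ t)) (λ t len → eq (x ∷ t) (cong suc len)))) (sym (Σtuples-∷ k N h′)))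

Σtuples-zero : ∀ k N {h} → (∀ t → h t ≡ 0) → Σtuples k N h ≡ 0
Σtuples-zero zero    N z = cong (_+ 0) (z [])
Σtuples-zero (suc k) N {h} z = trans (Σtuples-∷ k N h)
  (Σ<-zero (suc N) (λ x → Σtuples-zero k N (λ t → z (x ∷ t))))

-- `tuples` has the first coordinate outermost, whereas the multisums have s_K outermost;
-- interchanging sums passes from one to the other.
Σtuples-∷ʳ : ∀ k N h → Σtuples (suc k) N h ≡ Σ< (suc N) (λ x → Σtuples k N (λ t → h (t ++ [ x ])))
Σtuples-∷ʳ zero    N h = Σtuples-∷ zero N h
Σtuples-∷ʳ (suc k) N h = begin
  Σtuples (2 + k) N h
    ≡⟨ Σtuples-∷ (suc k) N h ⟩
  Σ< (suc N) (λ x → Σtuples (suc k) N (λ t → h (x ∷ t)))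
    ≡⟨ Σ<-cong (suc N) (λ x → Σtuples-∷ʳ k N (λ t → h (x ∷ t))) ⟩
  Σ< (suc N) (λ x → Σ< (suc N) (λ y → Σtuples k N (λ t → h (x ∷ t ++ [ y ]))))
    ≡⟨ Σ<-swap (suc N) (suc N) (λ x y → Σtuples k N (λ t → h (x ∷ t ++ [ y ]))) ⟩
  Σ< (suc N) (λ y → Σ< (suc N) (λ x → Σtuples k N (λ t → h (x ∷ t ++ [ y ]))))
    ≡⟨ Σ<-cong (suc N) (λ y → Σtuples-∷ k N (λ t → h (t ++ [ y ]))) ⟨
  Σ< (suc N) (λ y → Σtuples (suc k) N (λ t → h (t ++ [ y ]))) ∎

nonincr-ascent : ∀ t x y w → ¬ y ≤ x → nonincr (t ++ x ∷ y ∷ w) ≡ false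
nonincr-ascent [] x y w y≰x with y ≤? x
... | yes y≤x = contradiction y≤x y≰x
... | no _    = refl
nonincr-ascent (u ∷ []) x y w y≰x =
  trans (cong (⌊ x ≤? u ⌋ ∧_) (nonincr-ascent [] x y w y≰x)) (∧-zeroʳ _)
nonincr-ascent (u ∷ v ∷ t) x y w y≰x =
  trans (cong (⌊ v ≤? u ⌋ ∧_) (nonincr-ascent (v ∷ t) x y w y≰x)) (∧-zeroʳ _)

nonincr-descent : ∀ x y w → y ≤ x → nonincr (y ∷ w) ≡ true → nonincr (x ∷ y ∷ w) ≡ true
nonincr-descent x y w y≤x eq with y ≤? x
... | yes _   = eq
... | no y≰x = contradiction y≤x y≰x

-- 1 if position i, counted from 0, survives drop a, and 0 otherwise.
ind : ℕ → ℕ → ℕ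
ind a i = (suc i ∸ a) ∸ (i ∸ a)

ind-∸ : ∀ a i → (i ∸ a) + ind a i ≡ suc i ∸ a
ind-∸ a i = m+[n∸m]≡n (∸-monoˡ-≤ a (n≤1+n i))

sum-drop-∷ʳ : ∀ a t x → sum (drop a (t ++ [ x ])) ≡ sum (drop a t) + ind a (length t) * x
sum-drop-∷ʳ zero    t       x = trans (sum-++ t [ x ])
  (cong (λ z → sum t + z) (trans (+-identityʳ x) (sym (trans (cong (_* x) (m+n∸n≡m 1 (length t))) (*-identityˡ x)))))
sum-drop-∷ʳ (suc a) []      x rewrite 0∸n≡0 a = helper a
  where
  helper : ∀ a → sum (drop a ([] {A = ℕ})) ≡ 0
  helper zero    = refl
  helper (suc a) = refl
sum-drop-∷ʳ (suc a) (_ ∷ t) x = sum-drop-∷ʳ a t x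

pronic : ℕ → ℕ
pronic x = x * pred x

module _ (a b : ℕ) where

  -- One copy of each s_l is taken out of its square, so that the subtraction of s_1 + ⋯ + s_a
  -- leaves the sum over `drop a`.
  exponent : List ℕ → ℕ
  exponent s = sum (map pronic s) + (sum (drop a s) + sum (drop b s))

  lastExponent : ℕ → ℕ → ℕ
  lastExponent i x = pronic x + (ind a i * x + ind b i * x)

  -- The exponent of the tuple consisting of i entries x.
  constExponent : ℕ → ℕ → ℕ
  constExponent i x = i * pronic x + ((i ∸ a) * x + (i ∸ b) * x)

  exponent-∷ʳ : ∀ t x → exponent (t ++ [ x ]) ≡ exponent t + lastExponent (length t) x
  exponent-∷ʳ t x = trans
    (cong₂ _+_ (trans (cong sum (map-++ pronic t [ x ])) (sum-++ (map pronic t) [ pronic x ]))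
               (cong₂ _+_ (sum-drop-∷ʳ a t x) (sum-drop-∷ʳ b t x)))
    (arith (sum (map pronic t)) (sum (drop a t)) (sum (drop b t)) (pronic x) (ind a (length t) * x) (ind b (length t) * x))
    where
    arith : ∀ s t u x y z → s + (x + 0) + (t + y + (u + z)) ≡ s + (t + u) + (x + (y + z))
    arith = solve-∀

  constExponent-suc : ∀ i x → lastExponent i x + constExponent i x ≡ constExponent (suc i) x
  constExponent-suc i x = trans
    (arith (pronic x) (ind a i) (ind b i) x i (i ∸ a) (i ∸ b))
    (cong₂ (λ u v → suc i * pronic x + (u * x + v * x)) (ind-∸ a i) (ind-∸ b i))
    where
    arith : ∀ q u v x i d e → q + (u * x + v * x) + (i * q + (d * x + e * x)) ≡
                              (q + i * q) + ((d + u) * x + (e + v) * x)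
    arith = solve-∀

  ≤-suc-constExponent : ∀ i x → x ≤ suc (constExponent (suc i) x)
  ≤-suc-constExponent i zero    = z≤n
  ≤-suc-constExponent i (suc x) = s≤s (≤-trans (m≤m+n x (x * x))
    (≤-trans (m≤m+n (pronic (suc x)) (i * pronic (suc x))) (m≤m+n (suc i * pronic (suc x)) _)))

  pronic-+ : ∀ y m → pronic (y + m) ≡ pronic y + (pronic m + 2 * (y * m))
  pronic-+ zero    m = sym (+-identityʳ (pronic m))
  pronic-+ (suc y) zero rewrite +-identityʳ y | *-zeroʳ y = sym (+-identityʳ _)
  pronic-+ (suc y) (suc m) = arith y m
    where
    arith : ∀ y m → (suc y + suc m) * (y + suc m) ≡ suc y * y + (suc m * m + 2 * (suc y * suc m))
    arith = solve-∀

  -- Raising i + 1 equal entries from y to y + m produces the cross term 2y(i + 1)m, which is the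
  -- summand p l of the slope for p = 2y and l = i + 1.
  constExponent-+ : ∀ i y m →
    constExponent (suc i) y + quad i (slope (suc i) (2 * y) a b) m ≡ constExponent (suc i) (y + m)
  constExponent-+ i y m = trans
    (arith (pronic y) (pronic m) (suc i) y m (suc i ∸ a) (suc i ∸ b))
    (cong (λ z → suc i * z + ((suc i ∸ a) * (y + m) + (suc i ∸ b) * (y + m))) (sym (pronic-+ y m)))
    where
    arith : ∀ q q′ K y m d e → K * q + (d * y + e * y) + (K * q′ + (2 * y * K + (d + e)) * m) ≡
                               K * (q + (q′ + 2 * (y * m))) + (d * (y + m) + e * (y + m))
    arith = solve-∀

  -- `w` is the part of the tuple already fixed, `E` the exponent it contributes, and `t` the
  -- initial part still to be summed over.
  summand : ℕ → List ℕ → ℕ → List ℕ → ℕ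
  summand E w n t = if nonincr (t ++ w) then shift (E + exponent t) (denom (t ++ w)) n else 0

  summand-zero : ∀ E w n t → nonincr (t ++ w) ≡ false → summand E w n t ≡ 0
  summand-zero E w n t eq rewrite eq = refl

  summand-∷ʳ : ∀ E w n t x →
    summand E w n (t ++ [ x ]) ≡ summand (E + lastExponent (length t) x) (x ∷ w) n t
  summand-∷ʳ E w n t x rewrite ++-assoc t [ x ] w with nonincr (t ++ x ∷ w)
  ... | false = refl
  ... | true  = shift-≡ (denom (t ++ x ∷ w)) (trans (cong (E +_) (exponent-∷ʳ t x))
                  (arith E (exponent t) (lastExponent (length t) x))) n
    where
    arith : ∀ e x y → e + (x + y) ≡ e + y + x
    arith = solve-∀

  Σtuples-summand-∷ʳ : ∀ i N E w n → Σtuples (suc i) N (summand E w n) ≡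
    Σ< (suc N) (λ x → Σtuples i N (summand (E + lastExponent i x) (x ∷ w) n))
  Σtuples-summand-∷ʳ i N E w n = trans (Σtuples-∷ʳ i N (summand E w n))
    (Σ<-cong (suc N) (λ x → Σtuples-cong i N (λ t → summand E w n (t ++ [ x ])) (summand (E + lastExponent i x) (x ∷ w) n)
      (λ { t refl → summand-∷ʳ E w n t x })))

  -- Induction on the number of free coordinates: the last of them, x, satisfies x ≥ y, and m = x -
  -- y is the next variable of the multisum. For n < N the values of x beyond the box contribute
  -- nothing to the coefficient of q^n.
  Σtuples-summand : ∀ i N E y w n → suc n ≤ N → nonincr (y ∷ w) ≡ true →
    Σtuples i N (summand E (y ∷ w) n) ≡ shift (E + constExponent i y) (ser i (2 * y) a b (denom (y ∷ w))) n
  Σtuples-summand zero    N E y w n n<N ni rewrite ni = trans (+-identityʳ _)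
    (shift-≡ (denom (y ∷ w)) (cong (E +_) (trans (empty a b) (sym (cong₂ (λ u v → u * y + v * y) (0∸n≡0 a) (0∸n≡0 b))))) n)
    where
    drop-[] : ∀ a → sum (drop a ([] {A = ℕ})) ≡ 0
    drop-[] zero    = refl
    drop-[] (suc a) = refl
    empty : ∀ a b → exponent [] ≡ 0
    empty _ _ = cong₂ _+_ (drop-[] a) (drop-[] b)
  Σtuples-summand (suc i) N E y w n n<N ni = begin
    Σtuples (suc i) N (summand E (y ∷ w) n)
      ≡⟨ Σtuples-summand-∷ʳ i N E (y ∷ w) n ⟩
    Σ< (suc N) (λ x → Σtuples i N (summand (E + lastExponent i x) (x ∷ y ∷ w) n))
      ≡⟨ Σ<-cong (suc N) inner ⟩
    Σ< (suc N) f
      -- The range is lengthened by y so that `suc N` values remain once the y values below y are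
      -- dropped.
      ≡⟨ Σ<-extend f (m≤n+m (suc N) y) f-large ⟨
    Σ< (y + suc N) f
      ≡⟨ Σ<-drop y (suc N) f f-small ⟩
    Σ< (suc N) (λ m → f (y + m))
      ≡⟨ Σ<-cong (suc N) term ⟩
    Σ< (suc N) (λ m → shift e (shift (quad i c m) (H m)) n)
      ≡⟨ shift-Φ i c H e (s≤s n<N) ⟨
    shift e (Φ i c H) n ∎
    where
    G = denom (y ∷ w)
    e = E + constExponent (suc i) y
    c = slope (suc i) (2 * y) a b
    H : ℕ → PS
    H m = ser i (2 * y + 2 * m) a b (invQPoch 1 m ⊛ G)
    g f : ℕ → ℕ
    g x = shift (E + constExponent (suc i) x) (ser i (2 * x) a b (invQPoch 1 (x ∸ y) ⊛ G)) n
    f x = if ⌊ y ≤? x ⌋ then g x else 0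
    inner : ∀ x → Σtuples i N (summand (E + lastExponent i x) (x ∷ y ∷ w) n) ≡ f x
    inner x with y ≤? x
    ... | yes y≤x = trans (Σtuples-summand i N (E + lastExponent i x) x (y ∷ w) n n<N (nonincr-descent x y w y≤x ni))
      (shift-≡ (ser i (2 * x) a b (denom (x ∷ y ∷ w)))
        (trans (+-assoc E (lastExponent i x) (constExponent i x)) (cong (E +_) (constExponent-suc i x))) n)
    ... | no y≰x = Σtuples-zero i N (λ t → summand-zero (E + lastExponent i x) (x ∷ y ∷ w) n t (nonincr-ascent t x y w y≰x))
    f-large : ∀ x → suc N ≤ x → f x ≡ 0
    f-large x N<x with y ≤? x
    ... | no _  = refl
    ... | yes _ = shift-< (ser i (2 * x) a b (invQPoch 1 (x ∸ y) ⊛ G)) (≤-trans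
      (≤-pred (≤-trans (s≤s n<N) (≤-trans N<x (≤-suc-constExponent i x)))) (m≤n+m (constExponent (suc i) x) E))
    f-small : ∀ x → x < y → f x ≡ 0
    f-small x x<y with y ≤? x
    ... | no _    = refl
    ... | yes y≤x = contradiction y≤x (<⇒≱ x<y)
    term : ∀ m → f (y + m) ≡ shift e (shift (quad i c m) (H m)) n
    term m with y ≤? y + m
    ... | no y≰y+m = contradiction (m≤m+n y m) y≰y+m
    ... | yes _ = begin
      shift (E + constExponent (suc i) (y + m)) (ser i (2 * (y + m)) a b (invQPoch 1 (y + m ∸ y) ⊛ G)) n
        ≡⟨ cong₂ (λ p z → shift (E + constExponent (suc i) (y + m)) (ser i p a b (invQPoch 1 z ⊛ G)) n)
             (*-distribˡ-+ 2 y m) (m+n∸m≡n y m) ⟩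
      shift (E + constExponent (suc i) (y + m)) (H m) n
        ≡⟨ shift-≡ (H m) (trans (cong (E +_) (sym (constExponent-+ i y m))) (sym (+-assoc E _ _))) n ⟩
      shift (e + quad i c m) (H m) n
        ≡⟨ shift-shift e (quad i c m) (H m) n ⟨
      shift e (shift (quad i c m) (H m)) n ∎

  -- The last coordinate is split off first: it has no lower neighbour, and its denominator is
  -- (q^2;q^2).
  Σtuples-multisum : ∀ i N n → suc n ≤ N →
    Σtuples (suc i) N (summand 0 [] n) ≡ multisum i (invQPoch 2) 0 a b n
  Σtuples-multisum i N n n<N = begin
    Σtuples (suc i) N (summand 0 [] n)
      ≡⟨ Σtuples-summand-∷ʳ i N 0 [] n ⟩
    Σ< (suc N) (λ x → Σtuples i N (summand (lastExponent i x) [ x ] n))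
      ≡⟨ Σ<-cong (suc N) (λ x → trans (Σtuples-summand i N (lastExponent i x) x [] n n<N refl)
           (shift-≡ (ser i (2 * x) a b (invQPoch 2 x)) (exponents x) n)) ⟩
    Σ< (suc N) (λ x → shift (quad i (slope (suc i) 0 a b) x) (ser i (2 * x) a b (invQPoch 2 x)) n)
      ≡⟨ Φ-Σ< i (slope (suc i) 0 a b) (λ x → ser i (2 * x) a b (invQPoch 2 x)) (s≤s n<N) ⟨
    multisum i (invQPoch 2) 0 a b n ∎
    where
    exponents : ∀ x → lastExponent i x + constExponent i x ≡ quad i (slope (suc i) 0 a b) x
    exponents x = trans (constExponent-suc i x)
      (cong (suc i * pronic x +_) (sym (*-distribʳ-+ x (suc i ∸ a) (suc i ∸ b))))

-- Every square x^2 supplies a copy of x, and the copies from the first j entries cancel the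
-- subtracted sum, so the truncated subtraction is exact.
expo≡exponent : ∀ j r k s → expo j r k s ≡ exponent j (k ∸ r) s
expo≡exponent j r k s = trans (cong (_∸ sum (take j s)) (begin
  sum (map (λ x → x * x) s) + sum (drop (k ∸ r) s)
    ≡⟨ cong (_+ sum (drop (k ∸ r) s)) (squares s) ⟩
  sum (map pronic s) + sum s + sum (drop (k ∸ r) s)
    ≡⟨ cong (λ z → sum (map pronic s) + z + sum (drop (k ∸ r) s))
         (trans (cong sum (sym (take++drop≡id j s))) (sum-++ (take j s) (drop j s))) ⟩
  sum (map pronic s) + (sum (take j s) + sum (drop j s)) + sum (drop (k ∸ r) s)
    ≡⟨ arith (sum (map pronic s)) (sum (take j s)) (sum (drop j s)) (sum (drop (k ∸ r) s)) ⟩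
  exponent j (k ∸ r) s + sum (take j s) ∎))
  (m+n∸n≡m (exponent j (k ∸ r) s) (sum (take j s)))
  where
  arith : ∀ q t d e → q + (t + d) + e ≡ q + (d + e) + t
  arith = solve-∀
  square : ∀ x → x * x ≡ pronic x + x
  square zero    = refl
  square (suc x) = trans (*-suc (suc x) x) (+-comm (suc x) (suc x * x))
  squares : ∀ s → sum (map (λ x → x * x) s) ≡ sum (map pronic s) + sum s
  squares []      = refl
  squares (x ∷ s) = trans (cong₂ _+_ (square x) (squares s)) (+-interchange (pronic x) x _ _)

lhsTrunc≡multisum : ∀ j r i N n → suc n ≤ N →
  lhsTrunc j r (suc i) N n ≡ multisum i (invQPoch 2) 0 j (suc i ∸ r) n
lhsTrunc≡multisum j r i N n n<N = trans
  (Σtuples-cong (suc i) N (λ s → if nonincr s then termCoeff j r (suc i) s n else 0) (summand j b 0 [] n) (λ s _ → term s))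
  (Σtuples-multisum j (suc i ∸ r) i N n n<N)
  where
  b = suc i ∸ r
  term : ∀ s → (if nonincr s then termCoeff j r (suc i) s n else 0) ≡ summand j b 0 [] n s
  term s rewrite ++-identityʳ s with nonincr s
  ... | false = refl
  ... | true  = trans (shift-if (expo j r (suc i) s) (denom s) n) (shift-≡ (denom s) (expo≡exponent j r (suc i) s) n)

theorem1p15 : (j r k : ℕ) → 1 ≤ k → j + r ≤ k → (n : ℕ) →
    Σ (List (Vec ℕ (suc n))) (λ L →
    Unique L
    × ((f : Vec ℕ (suc n)) →
    (f ∈ L → size f ≡ n × Valid j r k (freq f))
    × (size f ≡ n × Valid j r k (freq f) → f ∈ L))
    × ((N : ℕ) → suc n ≤ N → lhsTrunc j r k N n ≡ length L))
theorem1p15 j r (suc k) 1≤k j+r≤k n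
  -- The instance p = 0, ℓ = n + 1, a = j, b = K - r; the hypothesis j + r ≤ K becomes a ≤ b.
  with counted k (suc n) 0 j (suc k ∸ r) n ≤-refl (m+n≤o⇒m≤o∸n j j+r≤k) (m∸n≤m (suc k) r)
... | L , unique , mem , len = L , unique ,
  (λ f → (λ f∈L → let w , ad = proj₁ (mem f) f∈L in trans (size≡weight f) w , Adm⇒Valid j+r≤k ad) ,
         (λ { (s , v) → proj₂ (mem f) (trans (sym (size≡weight f)) s , Valid⇒Adm j+r≤k v) })) ,
  (λ N n<N → trans (lhsTrunc≡multisum j r k N n n<N) len)
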